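{- Let $q$ be a prime power, and let $k,d \in \mathbb{N}$ be such that $\gcd(d+1, q^k-1) = 1$. Set $n = \sum_{r=0}^{d} q^{kr} = \frac{q^{k(d+1)}-1}{q^k-1}$. Then $h_q(n) = kd$.
   Context: For a prime power $q$ and $n \in \mathbb{N}$, let $\sigma:\mathbb{F}_q^n\to\mathbb{F}_q^n$ be the cyclic shift $\sigma(\sum_{i=1}^n x_i e_i)=\sum_{i=1}^n x_{i-1}e_i$ (indices mod $n$), where $e_1,\dots,e_n$ is the standard basis. A subspace $U\le \mathbb{F}_q^n$ is cyclically covering if $\bigcup_{r=0}^{n-1}\sigma^r(U)=\mathbb{F}_q^n$. $h_q(n)$ denotes the maximum possible codimension of a cyclically covering subspace of $\mathbb{F}_q^n$. -}

module Defs where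

open import Level using (0ℓ)
open import Data.Nat using (ℕ; zero; suc)
import Data.Nat as ℕ
open import Data.Fin using (Fin; zero; suc; fromℕ; inject₁)
open import Data.Product using (Σ; ∃; _×_; _,_)
open import Relation.Nullary using (¬_)
open import Relation.Binary.PropositionalEquality using (_≡_)
open import Algebra.Bundles using (CommutativeRing)
open import Relation.Binary.Definitions using (Decidable)

record FiniteField (q : ℕ) : Set₁ where
  field
    commRing : CommutativeRing 0ℓ 0ℓ
  open CommutativeRing commRing public
  field
    _≟_       : Decidable _≈_
    0≉1       : ¬ (0# ≈ 1#)
    inverse   : ∀ x → ¬ (x ≈ 0#) → ∃ λ y → (x * y) ≈ 1#
    enum      : Fin q → Carrier
    enum-inj  : ∀ i j → enum i ≈ enum j → i ≡ j
    enum-surj : ∀ x → ∃ λ i → enum i ≈ x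

geomSum : ℕ → ℕ → ℕ → ℕ
geomSum q k zero    = 1
geomSum q k (suc d) = geomSum q k d ℕ.+ q ℕ.^ (k ℕ.* suc d)

cpred : ∀ {m} → Fin (suc m) → Fin (suc m)
cpred {m} zero = fromℕ m
cpred (suc i)  = inject₁ i

module Space {q : ℕ} (F : FiniteField q) (n : ℕ) where
  open FiniteField F using (Carrier; _≈_; _+_; _*_; 0#)

  V : Set
  V = Fin n → Carrier

  _≈V_ : V → V → Set
  u ≈V v = ∀ i → u i ≈ v i

  0V : V
  0V _ = 0#

  _+V_ : V → V → V
  (u +V v) i = u i + v i

  _·V_ : Carrier → V → V
  (a ·V v) i = a * v i

  σ : V → V
  σ = shift n
    where
    shift : (m : ℕ) → (Fin m → Carrier) → Fin m → Carrier
    shift zero    x ()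
    shift (suc m) x i = x (cpred i)

  σ^ : ℕ → V → V
  σ^ zero    v = v
  σ^ (suc r) v = σ (σ^ r v)

  record Subspace : Set₁ where
    field
      _∈U     : V → Set
      resp    : ∀ {u v} → u ≈V v → u ∈U → v ∈U
      zero∈   : 0V ∈U
      +-closed : ∀ {u v} → u ∈U → v ∈U → (u +V v) ∈U
      ·-closed : ∀ a {v} → v ∈U → (a ·V v) ∈U
  open Subspace public

  lincomb : ∀ {m} → (Fin m → Carrier) → (Fin m → V) → V
  lincomb {zero}  c b = 0V
  lincomb {suc m} c b = (c zero ·V b zero) +V lincomb (λ j → c (suc j)) (λ j → b (suc j))

  record IsBasis (U : Subspace) {m : ℕ} (b : Fin m → V) : Set where
    field
      indep : ∀ (c : Fin m → Carrier) → lincomb c b ≈V 0V → ∀ j → c j ≈ 0#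
      span⊆ : ∀ (c : Fin m → Carrier) → (_∈U U) (lincomb c b)
      ⊆span : ∀ v → (_∈U U) v → ∃ λ (c : Fin m → Carrier) → v ≈V lincomb c b

  HasDim : Subspace → ℕ → Set
  HasDim U m = Σ (Fin m → V) λ b → IsBasis U b

  HasCodim : Subspace → ℕ → Set
  HasCodim U c = Σ ℕ λ m → HasDim U m × (m ℕ.+ c ≡ n)

  CyclicallyCovering : Subspace → Set
  CyclicallyCovering U =
    ∀ (x : V) → Σ ℕ λ r → Σ (r ℕ.< n) λ _ → Σ V λ u → (_∈U U) u × (x ≈V σ^ r u)

  hIs : ℕ → Set₁
  hIs h = (Σ Subspace λ U → CyclicallyCovering U × HasCodim U h)
        × (∀ (U : Subspace) (c : ℕ) → CyclicallyCovering U → HasCodim U c → c ℕ.≤ h)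

{-# OPTIONS --safe #-}
module Submission where

-- Let R be Fⁿ with cyclic convolution, that is F[X]/(Xⁿ - 1), so that σ is multiplication by X.
-- With N = k(d + 1) we have n (q^k - 1) = q^N - 1, hence x ^ (q^N) = x for all x in R: every power
-- x ^ (q^N - 1) is idempotent. The product of X^(n/p) - 1 over the primes p dividing n is nonzero,
-- and shrinking it by such idempotents gives an element e for which R with "x ~ y iff e x = e y" is
-- a field E in which X has order exactly n. Let L be the fixed field of x ↦ x ^ (q^k) in E and U
-- its preimage in Fⁿ. As n ≡ d + 1 mod q^k - 1, n is coprime to q^k - 1, so every nonzero x in E is
-- a power of X times an element of L, and U is cyclically covering.
--
-- The conjugates X^(q^j), j < N, are distinct in E, so the powers X^i, i < N, are independent over
-- F; as L has at most q^k elements, U has codimension at least k d. Conversely, if a subspace of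
-- codimension c is cyclically covering, then counting vectors gives q^c ≤ n < q^(k d + 1).

open import Defs
open import Level using (0ℓ)
open import Algebra.Bundles using (CommutativeRing)
import Algebra.Properties.Semiring.Exp as Exp
open import Data.Nat as ℕ using (ℕ; zero; suc; _∸_; s≤s; z≤n)
import Data.Nat.Properties as ℕ
open import Data.Nat.Combinatorics using (_C_; nCn≡1; nCk≡nC[n∸k])
open import Data.Nat.Coprimality using (Coprime; coprime-Bézout)
open import Data.Nat.Divisibility as ℕ using (_∣_; divides; _∣?_)
open import Data.Nat.DivMod using (_%_; _/_; m≡m%n+[m/n]*n; m%n<n; m<n⇒m%n≡m; [m+kn]%n≡m%n)
open import Data.Nat.GCD using (gcd; gcd-GCD; gcd[m,n]∣m; gcd[m,n]∣n; gcd-greatest; gcd-identityʳ; module Bézout)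
open import Data.Nat.ListAction using () renaming (product to productℕ)
open import Data.Nat.Primality using (Prime; prime?; euclidsLemma; ¬prime[0]; prime⇒nonTrivial)
open import Data.Nat.Primality.Factorisation using (factorise)
open import Data.Nat.Solver using (module +-*-Solver)
open import Data.Fin as Fin using (Fin; zero; suc; toℕ; fromℕ; fromℕ<; inject₁; inject≤; punchIn; funToFin; finToFun)
import Data.Fin.Properties as Fin
open import Data.Fin.Permutation using (Permutation; permutation; _⟨$⟩ʳ_)
open import Data.List using ([]; _∷_)
open import Data.List.Relation.Unary.All using (_∷_)
open import Data.Product using (∃; ∃₂; Σ; _×_; _,_; proj₁; proj₂)
open import Data.Sum using (_⊎_; inj₁; inj₂)
open import Data.Unit using (⊤; tt)
open import Function using (_∘_)
open import Relation.Binary.Definitions using (Decidable; tri<; tri≈; tri>)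
open import Relation.Binary.PropositionalEquality as ≡ using (_≡_)
open import Relation.Nullary using (¬_; contradiction; Dec; yes; no)
open import Relation.Nullary.Decidable using (decidable-stable)

-- A field with q^N elements is usually built from an irreducible polynomial. Here it is cut out of
-- the cyclic algebra instead, because that algebra already carries the shift: covering, a statement
-- about E, and codimension, a statement about Fⁿ, then concern the same vectors. Neither the size
-- of E nor its degree over F is ever computed. Root counts take their place. T^n - 1 has at most n
-- roots, so the n-th roots of unity in E are exactly the powers of X. T^(q^k) - T has at most q^k
-- roots, which bounds L. A polynomial over E with N coefficients and N distinct roots is zero,
-- which gives the independence of the powers of X. Since F is given only by an enumeration of its q
-- elements, even the additivity of q-th powers comes from a root count and not from the
-- characteristic. The subspace U is first known only as a decidable predicate, so a basis has to be
-- found by search. Its codimension is bounded below by counting vectors, and the general upper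
-- bound, applied to U itself, turns this into an equality.

module Sums (R : CommutativeRing 0ℓ 0ℓ) where
  open CommutativeRing R hiding (zero)
  open import Algebra.Properties.Semiring.Sum semiring public
  open import Relation.Binary.Reasoning.Setoid setoid

  δ : ∀ {n} → Fin n → Fin n → Carrier
  δ zero    zero    = 1#
  δ zero    (suc j) = 0#
  δ (suc i) zero    = 0#
  δ (suc i) (suc j) = δ i j

  δ-diag : ∀ {n} (i : Fin n) → δ i i ≈ 1#
  δ-diag zero    = refl
  δ-diag (suc i) = δ-diag i

  δ-off : ∀ {n} (i j : Fin n) → ¬ i ≡ j → δ i j ≈ 0#
  δ-off zero    zero    i≢j = contradiction ≡.refl i≢j
  δ-off zero    (suc j) i≢j = refl
  δ-off (suc i) zero    i≢j = refl
  δ-off (suc i) (suc j) i≢j = δ-off i j (i≢j ∘ ≡.cong suc)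

  sum-cong : ∀ {n} (f g : Fin n → Carrier) → (∀ i → f i ≈ g i) → sum f ≈ sum g
  sum-cong f g f≈g = sum-cong-≋ f≈g

  sum-zero : ∀ {n} (f : Fin n → Carrier) → (∀ i → f i ≈ 0#) → sum f ≈ 0#
  sum-zero {n} f f≈0 = trans (sum-cong f _ f≈0) (sum-replicate-zero n)

  sum-δ : ∀ {n} (i : Fin n) (f : Fin n → Carrier) → ∑[ j < n ] (δ i j * f j) ≈ f i
  sum-δ zero f = begin
    1# * f zero + sum (λ j → 0# * f (suc j)) ≈⟨ +-cong (*-identityˡ _) (sum-zero (λ j → 0# * f (suc j)) λ j → zeroˡ _) ⟩
    f zero + 0#                              ≈⟨ +-identityʳ _ ⟩
    f zero                                   ∎
  sum-δ (suc i) f = begin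
    0# * f zero + sum (λ j → δ i j * f (suc j)) ≈⟨ +-cong (zeroˡ _) (sum-δ i (f ∘ suc)) ⟩
    0# + f (suc i)                              ≈⟨ +-identityˡ _ ⟩
    f (suc i)                                   ∎

  sum-truncate : ∀ {m n} (m≤n : m ℕ.≤ n) (f : Fin n → Carrier) → (∀ i → m ℕ.≤ toℕ i → f i ≈ 0#) →
    sum f ≈ sum (λ i → f (inject≤ i m≤n))
  sum-truncate {zero} {n}      m≤n f f≈0 = sum-zero f (λ i → f≈0 i ℕ.z≤n)
  sum-truncate {suc m} {suc n} m≤n f f≈0 = +-congˡ (sum-truncate (ℕ.s≤s⁻¹ m≤n) (f ∘ suc) λ i m≤i → f≈0 (suc i) (ℕ.s≤s m≤i))

-- Root bounds for polynomials over a ring without zero divisors.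

NoZeroDivisors : CommutativeRing 0ℓ 0ℓ → Set
NoZeroDivisors R = ∀ x y → ¬ x ≈ 0# → x * y ≈ 0# → y ≈ 0#
  where open CommutativeRing R

module Roots (R : CommutativeRing 0ℓ 0ℓ) (cancel : NoZeroDivisors R) where
  open CommutativeRing R hiding (zero)

  open import Algebra.Properties.Semiring.Exp semiring using (_^_; ^-congˡ)
  open import Algebra.Properties.Group +-group using () renaming
    (x≈y⇒x∙y⁻¹≈ε to x≈y⇒x-y≈0; x∙y⁻¹≈ε⇒x≈y to x-y≈0⇒x≈y)
  open import Algebra.Solver.Ring.NaturalCoefficients.Default commutativeSemiring
    using (solve; _:+_; _:*_; _:=_)
  open import Relation.Binary.Reasoning.Setoid setoid
  open Sums R

  eval : ∀ {m} → (Fin m → Carrier) → Carrier → Carrier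
  eval c x = sum (λ i → c i * x ^ toℕ i)

  eval-cong : ∀ {m} (c : Fin m → Carrier) {x y} → x ≈ y → eval c x ≈ eval c y
  eval-cong c x≈y = sum-cong (λ i → c i * _ ^ toℕ i) _ λ i → *-congˡ (^-congˡ (toℕ i) x≈y)

  eval-suc : ∀ {m} (c : Fin (suc m) → Carrier) x → eval c x ≈ c zero + x * eval (c ∘ suc) x
  eval-suc c x = +-cong (*-identityʳ _) (begin
    sum (λ i → c (suc i) * (x * x ^ toℕ i)) ≈⟨ sum-cong (λ i → c (suc i) * (x * x ^ toℕ i)) (λ i → x * (c (suc i) * x ^ toℕ i)) (λ i →
      solve 3 (λ a b d → a :* (b :* d) := b :* (a :* d)) refl (c (suc i)) x (x ^ toℕ i)) ⟩
    sum (λ i → x * (c (suc i) * x ^ toℕ i)) ≈⟨ *-distribˡ-sum x (λ i → c (suc i) * x ^ toℕ i) ⟨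
    x * eval (c ∘ suc) x ∎)

  -- Synthetic division by T - a, evaluated at T = a + t so that no subtraction occurs.
  divide : ∀ {m} (c : Fin (suc m) → Carrier) a → ∃ λ (p : Fin m → Carrier) →
    (∀ t → eval c (a + t) ≈ eval c a + t * eval p (a + t)) ×
    ((∀ i → p i ≈ 0#) → ∀ i → c (suc i) ≈ 0#)
  divide {zero} c a = (λ ()) , (λ t → sym (trans (+-congˡ (zeroʳ t)) (+-identityʳ _))) , λ _ ()
  divide {suc m} c a with divide (c ∘ suc) a
  ... | p , div , vanish = p⁺ , div⁺ , vanish⁺
    where
    r = eval (c ∘ suc) a
    p⁺ : Fin (suc m) → Carrier
    p⁺ zero    = r
    p⁺ (suc i) = p i
    div⁺ : ∀ t → eval c (a + t) ≈ eval c a + t * eval p⁺ (a + t)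
    div⁺ t = begin
      eval c (a + t)                               ≈⟨ eval-suc c (a + t) ⟩
      c zero + (a + t) * eval (c ∘ suc) (a + t)    ≈⟨ +-congˡ (*-congˡ (div t)) ⟩
      c zero + (a + t) * (r + t * eval p (a + t))  ≈⟨
        solve 5 (λ c₀ a t r e → c₀ :+ (a :+ t) :* (r :+ t :* e) := (c₀ :+ a :* r) :+ t :* (r :+ (a :+ t) :* e))
          refl (c zero) a t r (eval p (a + t)) ⟩
      (c zero + a * r) + t * (r + (a + t) * eval p (a + t)) ≈⟨
        +-cong (eval-suc c a) (*-congˡ (eval-suc p⁺ (a + t))) ⟨
      eval c a + t * eval p⁺ (a + t) ∎
    vanish⁺ : (∀ i → p⁺ i ≈ 0#) → ∀ i → c (suc i) ≈ 0#
    vanish⁺ p⁺≈0 (suc i) = vanish (p⁺≈0 ∘ suc) i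
    vanish⁺ p⁺≈0 zero = begin
      c (suc zero)                             ≈⟨ +-identityʳ _ ⟨
      c (suc zero) + 0#                        ≈⟨ +-congˡ (trans (*-congˡ eval-tail) (zeroʳ a)) ⟨
      c (suc zero) + a * eval (λ i → c (suc (suc i))) a ≈⟨ eval-suc (λ i → c (suc i)) a ⟨
      r                                        ≈⟨ p⁺≈0 zero ⟩
      0#                                       ∎
      where
      eval-tail : eval (λ i → c (suc (suc i))) a ≈ 0#
      eval-tail = sum-zero (λ i → c (suc (suc i)) * a ^ toℕ i) λ i → trans (*-congʳ (vanish (p⁺≈0 ∘ suc) i)) (zeroˡ _)

  -- Divide by T - `r zero`. The quotient vanishes at the other roots, which differ from `r zero`,
  -- so by induction it is zero. Only the constant coefficient is left, and it is the value at a
  -- root.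
  vanishing-coefficients : ∀ {m} (c : Fin m → Carrier) (r : Fin m → Carrier) →
    (∀ i j → r i ≈ r j → i ≡ j) → (∀ i → eval c (r i) ≈ 0#) → ∀ i → c i ≈ 0#
  vanishing-coefficients {suc m} c r r-inj root = coeff
    where
    a = r zero
    p = proj₁ (divide c a)
    p-root : ∀ i → eval p (r (suc i)) ≈ 0#
    p-root i = cancel t _ t≉0 (begin
      t * eval p (r (suc i))           ≈⟨ *-congˡ (eval-cong p a+t) ⟨
      t * eval p (a + t)               ≈⟨ +-identityˡ _ ⟨
      0# + t * eval p (a + t)          ≈⟨ +-congʳ (root zero) ⟨
      eval c a + t * eval p (a + t)    ≈⟨ proj₁ (proj₂ (divide c a)) t ⟨
      eval c (a + t)                   ≈⟨ eval-cong c a+t ⟩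
      eval c (r (suc i))               ≈⟨ root (suc i) ⟩
      0# ∎)
      where
      t = r (suc i) - a
      a+t : a + t ≈ r (suc i)
      a+t = begin
        a + (r (suc i) - a)   ≈⟨ +-comm _ _ ⟩
        r (suc i) - a + a     ≈⟨ +-assoc _ _ _ ⟩
        r (suc i) + (- a + a) ≈⟨ +-congˡ (-‿inverseˡ a) ⟩
        r (suc i) + 0#        ≈⟨ +-identityʳ _ ⟩
        r (suc i)             ∎
      t≉0 : ¬ t ≈ 0#
      t≉0 t≈0 with () ← r-inj (suc i) zero (x-y≈0⇒x≈y _ _ t≈0)
    tail≈0 : ∀ i → c (suc i) ≈ 0#
    tail≈0 = proj₂ (proj₂ (divide c a)) (vanishing-coefficients p (r ∘ suc)
      (λ i j eq → Fin.suc-injective (r-inj (suc i) (suc j) eq)) p-root)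
    coeff : ∀ i → c i ≈ 0#
    coeff (suc i) = tail≈0 i
    coeff zero = begin
      c zero                        ≈⟨ +-identityʳ _ ⟨
      c zero + 0#                   ≈⟨ +-congˡ (trans (*-congˡ (sum-zero (λ i → c (suc i) * a ^ toℕ i) λ i → trans (*-congʳ (tail≈0 i)) (zeroˡ _))) (zeroʳ a)) ⟨
      c zero + a * eval (c ∘ suc) a ≈⟨ eval-suc c a ⟨
      eval c a                      ≈⟨ root zero ⟩
      0#                            ∎

  -- Root bound for the polynomial T^b - T^a.
  binomial-roots : ∀ {m} (b a : Fin m) → ¬ b ≡ a → ¬ 1# ≈ 0# → (r : Fin m → Carrier) →
    (∀ i j → r i ≈ r j → i ≡ j) → ¬ (∀ i → r i ^ toℕ b ≈ r i ^ toℕ a)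
  binomial-roots {m} b a b≢a 1≉0 r r-inj root = 1≉0 (begin
    1#              ≈⟨ δ-diag b ⟨
    δ b b           ≈⟨ +-identityʳ _ ⟨
    δ b b + 0#      ≈⟨ +-congˡ (trans (-‿cong (δ-off a b (b≢a ∘ ≡.sym))) -0#≈0#) ⟨
    δ b b - δ a b   ≈⟨ vanishing-coefficients c r r-inj c-root b ⟩
    0#              ∎)
    where
    open import Algebra.Properties.Ring ring using (-0#≈0#)
    c : Fin m → Carrier
    c i = δ b i - δ a i
    c-root : ∀ i → eval c (r i) ≈ 0#
    c-root i = begin
      sum (λ j → (δ b j - δ a j) * x ^ toℕ j) ≈⟨ +-identityʳ _ ⟨
      sum (λ j → (δ b j - δ a j) * x ^ toℕ j) + 0# ≈⟨ +-congˡ (-‿inverseʳ A) ⟨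
      sum (λ j → (δ b j - δ a j) * x ^ toℕ j) + (A - A) ≈⟨ +-assoc _ _ _ ⟨
      (sum (λ j → (δ b j - δ a j) * x ^ toℕ j) + A) - A ≈⟨ +-congʳ sumA ⟩
      B - A ≈⟨ x≈y⇒x-y≈0 (trans (sum-δ b _) (trans (root i) (sym (sum-δ a _)))) ⟩
      0# ∎
      where
      x = r i
      A = sum (λ j → δ a j * x ^ toℕ j)
      B = sum (λ j → δ b j * x ^ toℕ j)
      sumA : sum (λ j → (δ b j - δ a j) * x ^ toℕ j) + A ≈ B
      sumA = trans (sym (∑-distrib-+ (λ j → (δ b j - δ a j) * x ^ toℕ j) (λ j → δ a j * x ^ toℕ j)))
        (sum-cong (λ j → (δ b j - δ a j) * x ^ toℕ j + δ a j * x ^ toℕ j) (λ j → δ b j * x ^ toℕ j) λ j → begin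
          (δ b j - δ a j) * x ^ toℕ j + δ a j * x ^ toℕ j ≈⟨ distribʳ _ _ _ ⟨
          (δ b j - δ a j + δ a j) * x ^ toℕ j ≈⟨ *-congʳ (trans (+-assoc _ _ _) (trans (+-congˡ (-‿inverseˡ _)) (+-identityʳ _))) ⟩
          δ b j * x ^ toℕ j ∎)

module UnitPowers (R : CommutativeRing 0ℓ 0ℓ) where
  open CommutativeRing R
  open Exp semiring using (_^_)

  1^ : ∀ m → 1# ^ m ≈ 1#
  1^ zero    = refl
  1^ (suc m) = trans (*-identityˡ (1# ^ m)) (1^ m)

-- The binomial theorem and additivity of q-th powers.

module Frobenius (R : CommutativeRing 0ℓ 0ℓ) (r : ℕ) where
  open CommutativeRing R hiding (zero)
  open Sums R
  open import Algebra.Properties.Semiring.Mult semiring using (×-congˡ; ×-homo-1) renaming (_×_ to _⋆_)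
  open import Algebra.Properties.CommutativeSemiring.Exp commutativeSemiring using (_^_; ^-congˡ; ^-congʳ; ^-assocʳ)
  open import Algebra.Properties.CommutativeSemiring.Binomial commutativeSemiring
  open import Relation.Binary.Reasoning.Setoid setoid

  private
    q = 2 ℕ.+ r

  middleTerm : Carrier → Carrier → Fin (suc r) → Carrier
  middleTerm x y k = (q C suc (toℕ k)) ⋆ (x ^ suc (toℕ k) * y ^ (q ∸ suc (toℕ k)))

  -- Keeps the middle terms in one sum: in F this expansion serves to prove that the middle
  -- coefficients vanish, and afterwards, with `vanish` as a hypothesis, it yields additivity in
  -- F-algebras as well.
  binomial-split : ∀ x y → (x + y) ^ q ≈ y ^ q + (sum (middleTerm x y) + x ^ q)
  binomial-split x y = begin
    (x + y) ^ q ≈⟨ theorem q x y ⟩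
    binomialTerm x y q zero + sum (binomialTerm x y q ∘ suc)
      ≈⟨ +-cong first (trans (sum-init-last (binomialTerm x y q ∘ suc)) (+-cong middle last)) ⟩
    y ^ q + (sum (middleTerm x y) + x ^ q) ∎
    where
    first : binomialTerm x y q zero ≈ y ^ q
    first = trans (×-congˡ (≡.trans (nCk≡nC[n∸k] {0} {q} z≤n) (nCn≡1 q))) (trans (×-homo-1 _) (*-identityˡ _))
    last : binomialTerm x y q (fromℕ q) ≈ x ^ q
    last = begin
      binomialTerm x y q (fromℕ q)               ≡⟨ ≡.cong (λ k → (q C k) ⋆ (x ^ k * y ^ (q ∸ k))) (Fin.toℕ-fromℕ q) ⟩
      (q C q) ⋆ (x ^ q * y ^ (q ∸ q))            ≈⟨ ×-congˡ (nCn≡1 q) ⟩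
      1 ⋆ (x ^ q * y ^ (q ∸ q))                  ≈⟨ ×-homo-1 _ ⟩
      x ^ q * y ^ (q ∸ q)                        ≈⟨ *-congˡ (^-congʳ y (ℕ.n∸n≡0 q)) ⟩
      x ^ q * 1#                                 ≈⟨ *-identityʳ _ ⟩
      x ^ q ∎
    middle : sum (λ k → binomialTerm x y q (suc (inject₁ k))) ≈ sum (middleTerm x y)
    middle = sum-cong (λ k → binomialTerm x y q (suc (inject₁ k))) (middleTerm x y)
      λ k → reflexive (≡.cong (λ i → (q C suc i) ⋆ (x ^ suc i * y ^ (q ∸ suc i))) (Fin.toℕ-inject₁ k))

  module _ (vanish : ∀ (k : Fin (suc r)) z → (q C suc (toℕ k)) ⋆ z ≈ 0#) where

    ^q-+ : ∀ x y → (x + y) ^ q ≈ x ^ q + y ^ q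
    ^q-+ x y = begin
      (x + y) ^ q                            ≈⟨ binomial-split x y ⟩
      y ^ q + (sum (middleTerm x y) + x ^ q) ≈⟨ +-congˡ (+-congʳ (sum-zero (middleTerm x y) λ k → vanish k (x ^ suc (toℕ k) * y ^ (q ∸ suc (toℕ k))))) ⟩
      y ^ q + (0# + x ^ q)                   ≈⟨ +-congˡ (+-identityˡ _) ⟩
      y ^ q + x ^ q                          ≈⟨ +-comm _ _ ⟩
      x ^ q + y ^ q                          ∎

    ^q-sum : ∀ {m} (f : Fin m → Carrier) → sum f ^ q ≈ sum (λ i → f i ^ q)
    ^q-sum {zero}  f = zeroˡ _
    ^q-sum {suc m} f = trans (^q-+ _ _) (+-congˡ (^q-sum (f ∘ suc)))

    ^q^-+ : ∀ j x y → (x + y) ^ (q ℕ.^ j) ≈ x ^ (q ℕ.^ j) + y ^ (q ℕ.^ j)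
    ^q^-+ zero x y = trans (*-identityʳ _) (sym (+-cong (*-identityʳ _) (*-identityʳ _)))
    ^q^-+ (suc j) x y = begin
      (x + y) ^ (q ℕ.* q ℕ.^ j)                     ≈⟨ ^-assocʳ (x + y) q (q ℕ.^ j) ⟨
      ((x + y) ^ q) ^ (q ℕ.^ j)                     ≈⟨ ^-congˡ (q ℕ.^ j) (^q-+ x y) ⟩
      (x ^ q + y ^ q) ^ (q ℕ.^ j)                   ≈⟨ ^q^-+ j _ _ ⟩
      (x ^ q) ^ (q ℕ.^ j) + (y ^ q) ^ (q ℕ.^ j)     ≈⟨ +-cong (^-assocʳ x q (q ℕ.^ j)) (^-assocʳ y q (q ℕ.^ j)) ⟩
      x ^ (q ℕ.* q ℕ.^ j) + y ^ (q ℕ.* q ℕ.^ j)     ∎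

-- Finite fields: Fermat's theorem, binomial coefficients, codes of vectors.

module FieldProperties {r} (F : FiniteField (2 ℕ.+ r)) where
  open FiniteField F hiding (zero)
  open Sums commRing
  open import Algebra.Properties.Semiring.Mult semiring using (×-assoc-*; ×-congʳ) renaming (_×_ to _⋆_)
  open import Algebra.Properties.CommutativeSemiring.Exp commutativeSemiring using (_^_; ^-congˡ; ^-assocʳ)
  open import Algebra.Properties.Group +-group using (identityʳ-unique)
  open import Relation.Binary.Reasoning.Setoid setoid
  import Algebra.Properties.CommutativeMonoid.Sum *-commutativeMonoid as Product

  private
    q = 2 ℕ.+ r

  cancel : NoZeroDivisors commRing
  cancel x y x≉0 xy≈0 with inverse x x≉0
  ... | x⁻¹ , xx⁻¹≈1 = begin
    y             ≈⟨ *-identityˡ y ⟨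
    1# * y        ≈⟨ *-congʳ (trans (*-comm _ _) xx⁻¹≈1) ⟨
    x⁻¹ * x * y   ≈⟨ *-assoc _ _ _ ⟩
    x⁻¹ * (x * y) ≈⟨ *-congˡ xy≈0 ⟩
    x⁻¹ * 0#      ≈⟨ zeroʳ _ ⟩
    0#            ∎

  open Roots commRing cancel public

  index : Carrier → Fin q
  index x = proj₁ (enum-surj x)

  enum-index : ∀ x → enum (index x) ≈ x
  enum-index x = proj₂ (enum-surj x)

  index-cong : ∀ {x y} → x ≈ y → index x ≡ index y
  index-cong x≈y = enum-inj _ _ (trans (enum-index _) (trans x≈y (sym (enum-index _))))

  index-injective : ∀ {x y} → index x ≡ index y → x ≈ y
  index-injective {x} {y} eq = trans (sym (enum-index x)) (trans (reflexive (≡.cong enum eq)) (enum-index y))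

  index-enum : ∀ i → index (enum i) ≡ i
  index-enum i = enum-inj _ _ (enum-index (enum i))

  private
    -- Lets a product over all q elements stand for one over the nonzero elements: the factor at
    -- zero is replaced by `1#`.
    ifZero : Carrier → Carrier → Carrier → Carrier
    ifZero x a b with x ≟ 0#
    ... | yes _ = a
    ... | no  _ = b

    ifZero-yes : ∀ {x a b} → x ≈ 0# → ifZero x a b ≈ a
    ifZero-yes {x} x≈0 with x ≟ 0#
    ... | yes _  = refl
    ... | no x≉0 = contradiction x≈0 x≉0

    ifZero-no : ∀ {x a b} → ¬ x ≈ 0# → ifZero x a b ≈ b
    ifZero-no {x} x≉0 with x ≟ 0#
    ... | yes x≈0 = contradiction x≈0 x≉0
    ... | no _    = refl

  1≉0 : ¬ 1# ≈ 0#
  1≉0 1≈0 = 0≉1 (sym 1≈0)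

  product-nonzero : ∀ {m} (f : Fin m → Carrier) → (∀ i → ¬ f i ≈ 0#) → ¬ Product.sum f ≈ 0#
  product-nonzero {zero}  f f≉0 = 1≉0
  product-nonzero {suc m} f f≉0 eq = product-nonzero (f ∘ suc) (f≉0 ∘ suc) (cancel _ _ (f≉0 zero) eq)

  -- Multiplication by a permutes the nonzero elements, so scaling their product by a^(q-1) fixes it.
  fermat-unit : ∀ a → ¬ a ≈ 0# → a ^ suc r ≈ 1#
  fermat-unit a a≉0 with inverse a a≉0
  ... | b , ab≈1 = begin
      a ^ suc r                      ≈⟨ Product.sum-replicate (suc r) ⟨
      Product.sum {suc r} (λ _ → a)  ≈⟨ Product.sum-cong-≋ {suc r} (λ j → h-a (punchIn i₀ j) (Fin.punchInᵢ≢i i₀ j)) ⟨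
      Product.sum (λ j → h (punchIn i₀ j)) ≈⟨ *-identityˡ _ ⟨
      1# * Product.sum (λ j → h (punchIn i₀ j)) ≈⟨ *-congʳ (ifZero-yes (enum-index 0#)) ⟨
      h i₀ * Product.sum (λ j → h (punchIn i₀ j)) ≈⟨ Product.sum-remove h ⟨
      Product.sum h                  ≈⟨ x-y≈0⇒x≈y _ _ (cancel _ _ (product-nonzero g g≉0) Πg[Πh-1]≈0) ⟩
      1#                             ∎
    where
    open import Algebra.Properties.Group +-group using () renaming
      (x≈y⇒x∙y⁻¹≈ε to x≈y⇒x-y≈0; x∙y⁻¹≈ε⇒x≈y to x-y≈0⇒x≈y)
    open import Algebra.Properties.Ring ring using (x[y-z]≈xy-xz)
    i₀ = index 0#
    g h : Fin q → Carrier
    g i = ifZero (enum i) 1# (enum i)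
    h i = ifZero (enum i) 1# a
    g≉0 : ∀ i → ¬ g i ≈ 0#
    g≉0 i eq with enum i ≟ 0#
    ... | yes _ = 1≉0 eq
    ... | no x≉0 = x≉0 eq
    h-a : ∀ i → ¬ i ≡ i₀ → h i ≈ a
    h-a i i≢i₀ = ifZero-no λ x≈0 → i≢i₀ (enum-inj _ _ (trans x≈0 (sym (enum-index 0#))))
    mul-inv : ∀ {c d} → c * d ≈ 1# → ∀ i → index (c * enum (index (d * enum i))) ≡ i
    mul-inv {c} {d} cd≈1 i = ≡.trans (index-cong (begin
      c * enum (index (d * enum i)) ≈⟨ *-congˡ (enum-index _) ⟩
      c * (d * enum i)              ≈⟨ *-assoc _ _ _ ⟨
      c * d * enum i                ≈⟨ *-congʳ cd≈1 ⟩
      1# * enum i                   ≈⟨ *-identityˡ _ ⟩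
      enum i ∎)) (index-enum i)
    π : Permutation q q
    π = permutation (λ i → index (a * enum i)) (λ i → index (b * enum i))
      (mul-inv ab≈1) (mul-inv (trans (*-comm b a) ab≈1))
    -- Permuting by π multiplies each nonzero factor by a and leaves the placeholder at zero alone;
    -- `h` records exactly this.
    gπ : ∀ i → g (π ⟨$⟩ʳ i) ≈ g i * h i
    gπ i with enum i ≟ 0#
    ... | yes x≈0 = trans (ifZero-yes (trans (enum-index _) (trans (*-congˡ x≈0) (zeroʳ a)))) (sym (*-identityʳ _))
    ... | no x≉0  = trans (ifZero-no (λ eq → x≉0 (cancel _ _ a≉0 (trans (sym (enum-index _)) eq))))
                      (trans (enum-index _) (*-comm _ _))
    Πg≈ΠgΠh : Product.sum g ≈ Product.sum g * Product.sum h
    Πg≈ΠgΠh = trans (Product.sum-permute g π) (trans (Product.sum-cong-≋ gπ) (Product.∑-distrib-+ g h))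
    Πg[Πh-1]≈0 : Product.sum g * (Product.sum h - 1#) ≈ 0#
    Πg[Πh-1]≈0 = trans (x[y-z]≈xy-xz _ _ _) (x≈y⇒x-y≈0 (trans (sym Πg≈ΠgΠh) (sym (*-identityʳ _))))

  fermat : ∀ a → a ^ q ≈ a
  fermat a with a ≟ 0#
  ... | yes a≈0 = trans (*-congʳ a≈0) (trans (zeroˡ _) (sym a≈0))
  ... | no a≉0  = trans (*-congˡ (fermat-unit a a≉0)) (*-identityʳ a)

  fermat-^ : ∀ j a → a ^ (q ℕ.^ j) ≈ a
  fermat-^ zero    a = *-identityʳ a
  fermat-^ (suc j) a = trans (sym (^-assocʳ a q (q ℕ.^ j))) (trans (^-congˡ (q ℕ.^ j) (fermat a)) (fermat-^ j a))

  -- (x + 1)^q - x^q - 1 has degree less than q and vanishes on all of F.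
  binomial-vanishes : ∀ (k : Fin (suc r)) z → (q C suc (toℕ k)) ⋆ z ≈ 0#
  binomial-vanishes k z = begin
    (q C suc (toℕ k)) ⋆ z          ≈⟨ ×-congʳ (q C suc (toℕ k)) (*-identityˡ z) ⟨
    (q C suc (toℕ k)) ⋆ (1# * z)   ≈⟨ ×-assoc-* (q C suc (toℕ k)) 1# z ⟨
    c (suc k) * z                  ≈⟨ *-congʳ (vanishing-coefficients c enum enum-inj c-root (suc k)) ⟩
    0# * z                         ≈⟨ zeroˡ z ⟩
    0#                             ∎
    where
    open Frobenius commRing r
    open UnitPowers commRing
    c : Fin q → Carrier
    c zero    = 0#
    c (suc j) = (q C suc (toℕ j)) ⋆ 1#
    c-root : ∀ i → eval c (enum i) ≈ 0#
    c-root i = begin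
      eval c x                     ≈⟨ trans (+-congʳ (zeroˡ _)) (+-identityˡ _) ⟩
      sum (λ j → c (suc j) * x ^ suc (toℕ j)) ≈⟨ sum-cong (λ j → c (suc j) * x ^ suc (toℕ j)) (middleTerm x 1#) (λ j →
        trans (×-assoc-* (q C suc (toℕ j)) _ _) (×-congʳ (q C suc (toℕ j))
          (trans (*-identityˡ _) (sym (trans (*-congˡ (1^ (q ∸ suc (toℕ j)))) (*-identityʳ _)))))) ⟩
      -- By `fermat`, the expansion of (x + 1)^q reads x + 1 = 1 + (mid + x), so the middle part is
      -- zero.
      mid                          ≈⟨ identityʳ-unique (x + 1#) mid (begin
        x + 1# + mid               ≈⟨ trans (+-congʳ (+-comm x 1#)) (trans (+-assoc _ _ _) (+-congˡ (+-comm x mid))) ⟩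
        1# + (mid + x)             ≈⟨ +-cong (1^ q) (+-congˡ (fermat x)) ⟨
        1# ^ q + (mid + x ^ q)     ≈⟨ binomial-split x 1# ⟨
        (x + 1#) ^ q               ≈⟨ fermat (x + 1#) ⟩
        x + 1#                     ∎) ⟩
      0#                           ∎
      where
      x = enum i
      mid = sum (middleTerm x 1#)

  -- Vectors are functions up to pointwise equality. Through their codes, counting becomes
  -- injections between `Fin` types, and search over all vectors becomes finite.
  code : ∀ {m} → (Fin m → Carrier) → Fin (q ℕ.^ m)
  code c = funToFin (index ∘ c)

  decode : ∀ m → Fin (q ℕ.^ m) → Fin m → Carrier
  decode m i = enum ∘ finToFun i

  code-injective : ∀ {m} (c d : Fin m → Carrier) → code c ≡ code d → ∀ i → c i ≈ d i
  code-injective c d eq i = index-injective (≡.trans (≡.sym (Fin.finToFun-funToFin (index ∘ c) i))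
    (≡.trans (≡.cong (λ k → finToFun k i) eq) (Fin.finToFun-funToFin (index ∘ d) i)))

  decode-code : ∀ {m} (c : Fin m → Carrier) i → decode m (code c) i ≈ c i
  decode-code c i = trans (reflexive (≡.cong enum (Fin.finToFun-funToFin (index ∘ c) i))) (enum-index (c i))

  private
    funToFin-cong : ∀ {m} (f g : Fin m → Fin q) → (∀ i → f i ≡ g i) → funToFin f ≡ funToFin g
    funToFin-cong {zero}  f g eq = ≡.refl
    funToFin-cong {suc m} f g eq = ≡.cong₂ Fin.combine (eq zero) (funToFin-cong (f ∘ suc) (g ∘ suc) (eq ∘ suc))

  decode-injective : ∀ m (i j : Fin (q ℕ.^ m)) → (∀ k → decode m i k ≈ decode m j k) → i ≡ j
  decode-injective m i j eq = ≡.trans (≡.sym (Fin.funToFin-finToFin {m} i))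
    (≡.trans (funToFin-cong {m} (finToFun i) (finToFun j) λ k → enum-inj _ _ (eq k)) (Fin.funToFin-finToFin {m} j))

-- Linear algebra by counting, and the upper bound for covering subspaces.

module LinearAlgebra {r} (F : FiniteField (2 ℕ.+ r)) where
  open FiniteField F hiding (zero)
  open FieldProperties F
  open Sums commRing
  open import Algebra.Properties.Ring ring using (-‿distribˡ-*)
  open import Algebra.Properties.Group +-group using () renaming (x∙y⁻¹≈ε⇒x≈y to x-y≈0⇒x≈y; x≈y⇒x∙y⁻¹≈ε to x≈y⇒x-y≈0)
  open import Relation.Binary.Reasoning.Setoid setoid
  open Space

  private
    q = 2 ℕ.+ r

  σ^-cong : ∀ n k {u v : V F n} → _≈V_ F n u v → _≈V_ F n (σ^ F n k u) (σ^ F n k v)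
  σ^-cong n       zero    u≈v = u≈v
  σ^-cong (suc n) (suc k) u≈v i = σ^-cong (suc n) k u≈v (cpred i)

  lincomb-sum : ∀ n {m} c (b : Fin m → V F n) i → lincomb F n c b i ≈ sum (λ j → c j * b j i)
  lincomb-sum n {zero}  c b i = refl
  lincomb-sum n {suc m} c b i = +-congˡ (lincomb-sum n (c ∘ suc) (b ∘ suc) i)

  lincomb-cong : ∀ n {m} {c d : Fin m → Carrier} (b : Fin m → V F n) → (∀ j → c j ≈ d j) →
    _≈V_ F n (lincomb F n c b) (lincomb F n d b)
  lincomb-cong n {c = c} {d} b c≈d i = begin
    lincomb F n c b i        ≈⟨ lincomb-sum n c b i ⟩
    sum (λ j → c j * b j i)  ≈⟨ sum-cong (λ j → c j * b j i) _ (λ j → *-congʳ (c≈d j)) ⟩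
    sum (λ j → d j * b j i)  ≈⟨ lincomb-sum n d b i ⟨
    lincomb F n d b i        ∎

  lincomb-+ : ∀ n {m} (c d : Fin m → Carrier) (b : Fin m → V F n) i →
    lincomb F n (λ j → c j + d j) b i ≈ lincomb F n c b i + lincomb F n d b i
  lincomb-+ n c d b i = begin
    lincomb F n (λ j → c j + d j) b i         ≈⟨ lincomb-sum n _ b i ⟩
    sum (λ j → (c j + d j) * b j i)           ≈⟨ sum-cong (λ j → (c j + d j) * b j i) _ (λ j → distribʳ _ _ _) ⟩
    sum (λ j → c j * b j i + d j * b j i)     ≈⟨ ∑-distrib-+ (λ j → c j * b j i) (λ j → d j * b j i) ⟩
    sum (λ j → c j * b j i) + sum (λ j → d j * b j i) ≈⟨ +-cong (lincomb-sum n c b i) (lincomb-sum n d b i) ⟨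
    lincomb F n c b i + lincomb F n d b i     ∎

  coordinates-injective : ∀ n {U m} {b : Fin m → V F n} → IsBasis F n U b → ∀ c d →
    _≈V_ F n (lincomb F n c b) (lincomb F n d b) → ∀ j → c j ≈ d j
  coordinates-injective n {b = b} basis c d eq j = x-y≈0⇒x≈y _ _ (IsBasis.indep basis (λ j → c j - d j) c-d j)
    where
    c-d : _≈V_ F n (lincomb F n (λ j → c j - d j) b) (0V F n)
    c-d i = begin
      L (λ j → c j - d j)                   ≈⟨ +-identityʳ _ ⟨
      L (λ j → c j - d j) + 0#              ≈⟨ +-congˡ (-‿inverseʳ (L d)) ⟨
      L (λ j → c j - d j) + (L d - L d)     ≈⟨ +-assoc _ _ _ ⟨
      L (λ j → c j - d j) + L d - L d       ≈⟨ +-congʳ (lincomb-+ n (λ j → c j - d j) d b i) ⟨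
      L (λ j → c j - d j + d j) - L d       ≈⟨ +-congʳ (lincomb-cong n b (λ j →
        trans (+-assoc _ _ _) (trans (+-congˡ (-‿inverseˡ _)) (+-identityʳ _))) i) ⟩
      L c - L d                             ≈⟨ x≈y⇒x-y≈0 (eq i) ⟩
      0#                                    ∎
      where
      L = λ c → lincomb F n c b i

  -- Decoding coordinates produces q^m distinct vectors of U. The label `f` may depend on the
  -- membership proof and need not respect equality of vectors.
  dim-bound : ∀ n {U m} → HasDim F n U m → ∀ {A} (f : ∀ u → _∈U U u → Fin A) →
    (∀ {u v} u∈U v∈U → f u u∈U ≡ f v v∈U → _≈V_ F n u v) → q ℕ.^ m ℕ.≤ A
  dim-bound n {U} {m} (b , basis) f f-inj = Fin.injective⇒≤
    {f = λ i → f (lincomb F n (decode m i) b) (IsBasis.span⊆ basis (decode m i))}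
    λ {i} {j} eq → decode-injective m i j (coordinates-injective n {U} basis _ _
      (f-inj (IsBasis.span⊆ basis (decode m i)) (IsBasis.span⊆ basis (decode m j)) eq))

  -- A shift below n and the m coordinates of a vector of U determine the covered vector, so q^n ≤ n
  -- q^m, and q^m cancels.
  covering-codim : ∀ n U c → CyclicallyCovering F n U → HasCodim F n U c → q ℕ.^ c ℕ.≤ n
  covering-codim n U c cover (m , (b , basis) , m+c≡n) = ℕ.*-cancelʳ-≤ (q ℕ.^ c) n (q ℕ.^ m)
    {{ℕ.m^n≢0 q m}} (ℕ.≤-trans (ℕ.≤-reflexive eq) (Fin.injective⇒≤ {f = encode} encode-injective))
    where
    eq : q ℕ.^ c ℕ.* q ℕ.^ m ≡ q ℕ.^ n
    eq = ≡.trans (≡.sym (ℕ.^-distribˡ-+-* q c m)) (≡.cong (q ℕ.^_) (≡.trans (ℕ.+-comm c m) m+c≡n))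
    shift : V F n → Fin n
    shift x with cover x
    ... | k , k<n , _ = fromℕ< k<n
    coords : V F n → Fin m → Carrier
    coords x with cover x
    ... | _ , _ , u , u∈U , _ = proj₁ (IsBasis.⊆span basis u u∈U)
    rebuild : ∀ x → _≈V_ F n x (σ^ F n (toℕ (shift x)) (lincomb F n (coords x) b))
    rebuild x with cover x
    ... | k , k<n , u , u∈U , x≈σu = λ i → trans (x≈σu i)
      (trans (σ^-cong n k (proj₂ (IsBasis.⊆span basis u u∈U)) i)
        (reflexive (≡.cong (λ k → σ^ F n k _ i) (≡.sym (Fin.toℕ-fromℕ< k<n)))))
    encode : Fin (q ℕ.^ n) → Fin (n ℕ.* q ℕ.^ m)
    encode i = Fin.combine (shift (decode n i)) (code (coords (decode n i)))
    encode-injective : ∀ {i j} → encode i ≡ encode j → i ≡ j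
    encode-injective {i} {j} eq with Fin.combine-injective (shift (decode n i)) (code (coords (decode n i)))
                                      (shift (decode n j)) (code (coords (decode n j))) eq
    ... | eq₁ , eq₂ = decode-injective n i j λ k → begin
      decode n i k ≈⟨ rebuild (decode n i) k ⟩
      σ^ F n (toℕ (shift (decode n i))) (lincomb F n (coords (decode n i)) b) k
        ≡⟨ ≡.cong (λ s → σ^ F n (toℕ s) (lincomb F n (coords (decode n i)) b) k) eq₁ ⟩
      σ^ F n (toℕ (shift (decode n j))) (lincomb F n (coords (decode n i)) b) k
        ≈⟨ σ^-cong n (toℕ (shift (decode n j))) (lincomb-cong n b (code-injective (coords (decode n i)) (coords (decode n j)) eq₂)) k ⟩
      σ^ F n (toℕ (shift (decode n j))) (lincomb F n (coords (decode n j)) b) k ≈⟨ rebuild (decode n j) k ⟨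
      decode n j k ∎

  private
    cons : ∀ {n} → Carrier → V F n → V F (suc n)
    cons a v zero    = a
    cons a v (suc i) = v i

    cons-cong : ∀ {n a} {u v : V F n} → _≈V_ F n u v → _≈V_ F (suc n) (cons a u) (cons a v)
    cons-cong u≈v zero    = refl
    cons-cong u≈v (suc i) = u≈v i

    lincomb-cons : ∀ {n m} c (b : Fin m → V F n) → _≈V_ F (suc n) (lincomb F (suc n) c (cons 0# ∘ b)) (cons 0# (lincomb F n c b))
    lincomb-cons c b zero = trans (lincomb-sum _ c (cons 0# ∘ b) zero) (sum-zero (λ j → c j * 0#) λ j → zeroʳ _)
    lincomb-cons c b (suc i) = trans (lincomb-sum _ c (cons 0# ∘ b) (suc i)) (sym (lincomb-sum _ c b i))

    slice : ∀ {n} → Subspace F (suc n) → Subspace F n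
    slice U = record
      { _∈U      = λ v → _∈U U (cons 0# v)
      ; resp     = λ u≈v → resp U (cons-cong u≈v)
      ; zero∈    = resp U (λ { zero → refl ; (suc i) → refl }) (zero∈ U)
      ; +-closed = λ u∈ v∈ → resp U (λ { zero → +-identityˡ 0# ; (suc i) → refl }) (+-closed U u∈ v∈)
      ; ·-closed = λ a v∈ → resp U (λ { zero → zeroʳ a ; (suc i) → refl }) (·-closed U a v∈)
      }

  -- Induction on n through the slice of vectors with first coordinate 0. A search over codes looks
  -- for a vector of U with first coordinate 1. If there is one, it extends the basis of the slice,
  -- and subtracting a multiple of it clears any first coordinate. If there is none, scaling shows
  -- that U has no vector with nonzero first coordinate.
  decidable⇒basis : ∀ n (U : Subspace F n) → (∀ v → Dec (_∈U U v)) → ∃ (HasDim F n U)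
  decidable⇒basis zero U U? = 0 , (λ ()) , record
    { indep = λ _ _ () ; span⊆ = λ _ → zero∈ U ; ⊆span = λ _ _ → (λ ()) , λ () }
  decidable⇒basis (suc n) U U? with decidable⇒basis n (slice U) (λ v → U? (cons 0# v))
    | Fin.any? (λ i → U? (cons 1# (decode n i)))
  ... | m , b , basis | no no-pivot = m , cons 0# ∘ b , record
    { indep = λ c eq → indep c λ i → trans (sym (lincomb-cons c b (suc i))) (eq (suc i))
    ; span⊆ = λ c → resp U (λ i → sym (lincomb-cons c b i)) (span⊆ c)
    ; ⊆span = λ v v∈U → let v₀≈0 = head≈0 v v∈U
                            c , v≈ = ⊆span (v ∘ suc) (resp U (λ { zero → v₀≈0 ; (suc i) → refl }) v∈U)
                        in c , λ { zero    → trans v₀≈0 (sym (lincomb-cons c b zero))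
                                 ; (suc i) → trans (v≈ i) (sym (lincomb-cons c b (suc i))) }
    }
    where
    open IsBasis basis
    head≈0 : ∀ v → _∈U U v → v zero ≈ 0#
    head≈0 v v∈U with v zero ≟ 0#
    ... | yes eq = eq
    ... | no v₀≉0 with inverse (v zero) v₀≉0
    ...   | a , v₀a≈1 = contradiction
      (code (λ i → a * v (suc i)) , resp U (λ { zero → trans (*-comm _ _) v₀a≈1
                                              ; (suc i) → sym (decode-code (λ i → a * v (suc i)) i) }) (·-closed U a v∈U))
      no-pivot
  ... | m , b , basis | yes (i₀ , u∈U) = suc m , b⁺ , record
    { indep = λ c eq → let c₀≈0 = trans (sym (lincomb-head c)) (eq zero) in
                λ { zero → c₀≈0
                  ; (suc j) → indep (c ∘ suc) (λ i → begin
                      lincomb F n (c ∘ suc) b i ≈⟨ lincomb-cons (c ∘ suc) b (suc i) ⟨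
                      lincomb F (suc n) (c ∘ suc) (b⁺ ∘ suc) (suc i) ≈⟨ +-identityˡ _ ⟨
                      0# + lincomb F (suc n) (c ∘ suc) (b⁺ ∘ suc) (suc i) ≈⟨ +-congʳ (trans (*-congʳ c₀≈0) (zeroˡ _)) ⟨
                      lincomb F (suc n) c b⁺ (suc i) ≈⟨ eq (suc i) ⟩
                      0# ∎) j }
    ; span⊆ = λ c → +-closed U (·-closed U (c zero) u∈U) (resp U (λ i → sym (lincomb-cons (c ∘ suc) b i)) (span⊆ (c ∘ suc)))
    ; ⊆span = λ v v∈U →
        let c , rest≈ = ⊆span (λ i → v (suc i) + - v zero * u (suc i))
              (resp U (λ { zero → trans (+-congˡ (*-identityʳ _)) (-‿inverseʳ _) ; (suc i) → refl })
                (+-closed U v∈U (·-closed U (- v zero) u∈U)))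
        in cons (v zero) c , λ
          { zero → sym (lincomb-head (cons (v zero) c))
          ; (suc i) → begin
              v (suc i)                                                  ≈⟨ +-identityˡ _ ⟨
              0# + v (suc i)                                             ≈⟨ +-congʳ (-‿inverseʳ (v zero * u (suc i))) ⟨
              v zero * u (suc i) - v zero * u (suc i) + v (suc i)        ≈⟨ +-assoc _ _ _ ⟩
              v zero * u (suc i) + (- (v zero * u (suc i)) + v (suc i))  ≈⟨ +-congˡ (trans (+-comm _ _) (+-congˡ (-‿distribˡ-* _ _))) ⟩
              v zero * u (suc i) + (v (suc i) + - v zero * u (suc i))    ≈⟨ +-congˡ (rest≈ i) ⟩
              v zero * u (suc i) + lincomb F n c b i                     ≈⟨ +-congˡ (lincomb-cons c b (suc i)) ⟨
              v zero * u (suc i) + lincomb F (suc n) c (b⁺ ∘ suc) (suc i) ∎ }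
    }
    where
    open IsBasis basis
    u = cons 1# (decode n i₀)
    b⁺ : Fin (suc m) → V F (suc n)
    b⁺ zero    = u
    b⁺ (suc j) = cons 0# (b j)
    lincomb-head : ∀ c → lincomb F (suc n) c b⁺ zero ≈ c zero
    lincomb-head c = trans (+-cong (*-identityʳ _) (lincomb-cons (c ∘ suc) b zero)) (+-identityʳ _)

  full : ∀ n → Subspace F n
  full n = record { _∈U = λ _ → ⊤ ; resp = λ _ _ → tt ; zero∈ = tt ; +-closed = λ _ _ → tt ; ·-closed = λ _ _ → tt }

  full-codim : HasCodim F 1 (full 1) 0
  full-codim = 1 , ((λ _ _ → 1#) , record
    { indep = λ { c eq zero → trans (sym (head c)) (eq zero) }
    ; span⊆ = λ _ → _
    ; ⊆span = λ v _ → v , λ { zero → sym (head v) } }) , ≡.refl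
    where
    head : ∀ (c : Fin 1 → Carrier) → c zero * 1# + 0# ≈ c zero
    head c = trans (+-identityʳ _) (*-identityʳ _)

-- The algebra F[X]/(Xⁿ - 1) on Fⁿ.

module CyclicAlgebra {r} (F : FiniteField (2 ℕ.+ r)) (n′ : ℕ) where
  private
    q = 2 ℕ.+ r
    n = suc n′

  module F = FiniteField F
  open F using () renaming (Carrier to K; _≈_ to _≈F_; _+_ to _+F_; _*_ to _*F_)
  open Space F n using (V; _≈V_; 0V; _+V_; _·V_; σ; σ^)
  module Sum = Sums F.commRing
  open Sum using () renaming (sum to ∑)
  open import Relation.Binary.Reasoning.Setoid F.setoid

  -- The index j - k mod n; the k-th power of the shift is precomposition with it.
  rotate : ℕ → Fin n → Fin n
  rotate zero    j = j
  rotate (suc k) j = rotate k (cpred j)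

  σ^-rotate : ∀ k (v : V) j → σ^ k v j ≡ v (rotate k j)
  σ^-rotate zero    v j = ≡.refl
  σ^-rotate (suc k) v j = σ^-rotate k v (cpred j)

  rotate-+ : ∀ k l j → rotate k (rotate l j) ≡ rotate (l ℕ.+ k) j
  rotate-+ k zero    j = ≡.refl
  rotate-+ k (suc l) j = rotate-+ k l (cpred j)

  rotate-comm : ∀ k l j → rotate k (rotate l j) ≡ rotate l (rotate k j)
  rotate-comm k l j = ≡.trans (rotate-+ k l j)
    (≡.trans (≡.cong (λ s → rotate s j) (ℕ.+-comm l k)) (≡.sym (rotate-+ l k j)))

  -- The congruence is written without subtraction; c counts how often the index wraps around from 0
  -- to n - 1.
  rotate-toℕ : ∀ k j → ∃ λ c → toℕ (rotate k j) ℕ.+ k ≡ toℕ j ℕ.+ c ℕ.* n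
  rotate-toℕ zero    j = 0 , ≡.refl
  rotate-toℕ (suc k) zero with rotate-toℕ k (fromℕ n′)
  ... | c , eq = suc c , ≡.trans (ℕ.+-suc _ k) (≡.trans (≡.cong suc eq) (≡.cong (λ m → suc (m ℕ.+ c ℕ.* n)) (Fin.toℕ-fromℕ n′)))
  rotate-toℕ (suc k) (suc j) with rotate-toℕ k (inject₁ j)
  ... | c , eq = c , ≡.trans (ℕ.+-suc _ k) (≡.trans (≡.cong suc eq) (≡.cong (λ m → suc (m ℕ.+ c ℕ.* n)) (Fin.toℕ-inject₁ j)))

  rotate-n : ∀ j → rotate n j ≡ j
  rotate-n j with rotate-toℕ n j
  ... | c , eq = Fin.toℕ-injective (≡.trans (≡.sym (m<n⇒m%n≡m (Fin.toℕ<n (rotate n j))))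
    (≡.trans (≡.sym ([m+kn]%n≡m%n (toℕ (rotate n j)) 1 n))
    (≡.trans (≡.cong (_% n) (≡.trans (≡.cong (toℕ (rotate n j) ℕ.+_) (ℕ.+-identityʳ n)) eq))
    (≡.trans ([m+kn]%n≡m%n (toℕ j) c n) (m<n⇒m%n≡m (Fin.toℕ<n j))))))

  one : V
  one = Sum.δ zero

  -- This is the fact that X^i, for i < n, is the i-th standard basis vector.
  one-rotate : ∀ i j → one (rotate (toℕ i) j) ≈F Sum.δ i j
  one-rotate i = go (toℕ i) i ≡.refl
    where
    δ-cpred : ∀ (i : Fin n′) j → Sum.δ (inject₁ i) (cpred j) ≈F Sum.δ (suc i) j
    δ-cpred i zero    = Sum.δ-off (inject₁ i) (fromℕ n′) (Fin.fromℕ≢inject₁ ∘ ≡.sym)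
    δ-cpred i (suc j) = δ-inject i j
      where
      δ-inject : ∀ {m} (i j : Fin m) → Sum.δ (inject₁ i) (inject₁ j) ≈F Sum.δ i j
      δ-inject zero    zero    = F.refl
      δ-inject zero    (suc j) = F.refl
      δ-inject (suc i) zero    = F.refl
      δ-inject (suc i) (suc j) = δ-inject i j
    go : ∀ k i → toℕ i ≡ k → ∀ j → one (rotate k j) ≈F Sum.δ i j
    go zero    zero    eq j = F.refl
    go (suc k) (suc i) eq j = F.trans (go k (inject₁ i) (≡.trans (Fin.toℕ-inject₁ i) (ℕ.suc-injective eq)) (cpred j)) (δ-cpred i j)

  infixl 7 _⊛_

  -- Opaque because unfolding products makes type checking infeasible.
  opaque
    _⊛_ : V → V → V
    (x ⊛ y) j = ∑ (λ i → x i *F y (rotate (toℕ i) j))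

    ⊛-cong : ∀ {x x′ y y′} → x ≈V x′ → y ≈V y′ → (x ⊛ y) ≈V (x′ ⊛ y′)
    ⊛-cong {x} {x′} {y} {y′} x≈x′ y≈y′ j = Sum.sum-cong (λ i → x i *F y (rotate (toℕ i) j)) (λ i → x′ i *F y′ (rotate (toℕ i) j))
      λ i → F.*-cong (x≈x′ i) (y≈y′ _)

    ⊛-identityʳ : ∀ x → (x ⊛ one) ≈V x
    ⊛-identityʳ x j = begin
      ∑ (λ i → x i *F one (rotate (toℕ i) j)) ≈⟨ Sum.sum-cong (λ i → x i *F one (rotate (toℕ i) j)) (λ i → Sum.δ j i *F x i)
        (λ i → F.trans (F.*-comm _ _) (F.*-congʳ (F.trans (one-rotate i j) (δ-sym i j)))) ⟩
      ∑ (λ i → Sum.δ j i *F x i) ≈⟨ Sum.sum-δ j x ⟩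
      x j ∎
      where
      δ-sym : ∀ {m} (i j : Fin m) → Sum.δ i j ≈F Sum.δ j i
      δ-sym zero    zero    = F.refl
      δ-sym zero    (suc j) = F.refl
      δ-sym (suc i) zero    = F.refl
      δ-sym (suc i) (suc j) = δ-sym i j

    -- Writing y as `y ⊛ one`, and later x as `x ⊛ one`, turns both sides into the double sum of x i
    -- y k over i + k = j mod n. The two sums are then exchanged, and no sum has to be reindexed by
    -- a permutation.
    ⊛-comm : ∀ x y → (x ⊛ y) ≈V (y ⊛ x)
    ⊛-comm x y j = begin
      ∑ (λ i → x i *F y (rotate (toℕ i) j))
        ≈⟨ Sum.sum-cong (λ i → x i *F y (rotate (toℕ i) j)) (λ i → ∑ (λ k → term i k)) (λ i →
           F.trans (F.*-congˡ (F.sym (⊛-identityʳ y (rotate (toℕ i) j))))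
             (Sum.*-distribˡ-sum (x i) (λ k → y k *F one (rotate (toℕ k) (rotate (toℕ i) j))))) ⟩
      ∑ (λ i → ∑ (λ k → term i k)) ≈⟨ Sum.∑-comm term ⟩
      ∑ (λ k → ∑ (λ i → term i k))
        ≈⟨ Sum.sum-cong (λ k → ∑ (λ i → term i k)) (λ k → y k *F x (rotate (toℕ k) j)) (λ k → begin
           ∑ (λ i → term i k) ≈⟨ Sum.sum-cong (λ i → term i k) (λ i → y k *F (x i *F one (rotate (toℕ i) (rotate (toℕ k) j)))) (λ i →
             F.trans (F.sym (F.*-assoc _ _ _)) (F.trans (F.*-congʳ (F.*-comm _ _)) (F.trans (F.*-assoc _ _ _)
               (F.*-congˡ (F.*-congˡ (F.reflexive (≡.cong one (rotate-comm (toℕ k) (toℕ i) j)))))))) ⟩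
           ∑ (λ i → y k *F (x i *F one (rotate (toℕ i) (rotate (toℕ k) j)))) ≈⟨ Sum.*-distribˡ-sum (y k) (λ i → x i *F one (rotate (toℕ i) (rotate (toℕ k) j))) ⟨
           y k *F ((x ⊛ one) (rotate (toℕ k) j)) ≈⟨ F.*-congˡ (⊛-identityʳ x _) ⟩
           y k *F x (rotate (toℕ k) j) ∎) ⟩
      ∑ (λ k → y k *F x (rotate (toℕ k) j)) ∎
      where
      term : Fin n → Fin n → K
      term i k = x i *F (y k *F one (rotate (toℕ k) (rotate (toℕ i) j)))

    ⊛-rotateʳ : ∀ x y l j → (x ⊛ (y ∘ rotate l)) j ≈F (x ⊛ y) (rotate l j)
    ⊛-rotateʳ x y l j = Sum.sum-cong (λ i → x i *F y (rotate l (rotate (toℕ i) j))) (λ i → x i *F y (rotate (toℕ i) (rotate l j)))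
      λ i → F.*-congˡ (F.reflexive (≡.cong y (rotate-comm l (toℕ i) j)))

    ⊛-rotateˡ : ∀ x y l j → ((x ∘ rotate l) ⊛ y) j ≈F (x ⊛ y) (rotate l j)
    ⊛-rotateˡ x y l j = F.trans (⊛-comm (x ∘ rotate l) y j) (F.trans (⊛-rotateʳ y x l j) (⊛-comm y x (rotate l j)))

    -- After the exchange of sums the inner sum is the product of a shifted y with z, and
    -- `⊛-rotateˡ` moves the shift outside.
    ⊛-assoc : ∀ x y z → ((x ⊛ y) ⊛ z) ≈V (x ⊛ (y ⊛ z))
    ⊛-assoc x y z j = begin
      ∑ (λ k → (x ⊛ y) k *F z (rotate (toℕ k) j))
        ≈⟨ Sum.sum-cong (λ k → (x ⊛ y) k *F z (rotate (toℕ k) j)) (λ k → ∑ (λ i → term i k)) (λ k → F.trans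
          (Sum.*-distribʳ-sum (z (rotate (toℕ k) j)) (λ i → x i *F y (rotate (toℕ i) k)))
          (Sum.sum-cong (λ i → x i *F y (rotate (toℕ i) k) *F z (rotate (toℕ k) j)) (λ i → term i k) λ i → F.*-assoc _ _ _)) ⟩
      ∑ (λ k → ∑ (λ i → term i k)) ≈⟨ Sum.∑-comm (λ k i → term i k) ⟩
      ∑ (λ i → ∑ (λ k → term i k))
        ≈⟨ Sum.sum-cong (λ i → ∑ (λ k → term i k)) (λ i → x i *F (y ⊛ z) (rotate (toℕ i) j)) (λ i → F.trans
          (F.sym (Sum.*-distribˡ-sum (x i) (λ k → y (rotate (toℕ i) k) *F z (rotate (toℕ k) j))))
          (F.*-congˡ (⊛-rotateˡ y z (toℕ i) j))) ⟩
      ∑ (λ i → x i *F (y ⊛ z) (rotate (toℕ i) j)) ∎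
      where
      term : Fin n → Fin n → K
      term i k = x i *F (y (rotate (toℕ i) k) *F z (rotate (toℕ k) j))

    ⊛-distribˡ : ∀ x y z → (x ⊛ (y +V z)) ≈V ((x ⊛ y) +V (x ⊛ z))
    ⊛-distribˡ x y z j = F.trans
      (Sum.sum-cong (λ i → x i *F (y (rotate (toℕ i) j) +F z (rotate (toℕ i) j)))
        (λ i → x i *F y (rotate (toℕ i) j) +F x i *F z (rotate (toℕ i) j)) λ i → F.distribˡ _ _ _)
      (Sum.∑-distrib-+ (λ i → x i *F y (rotate (toℕ i) j)) (λ i → x i *F z (rotate (toℕ i) j)))

    ⊛-sum : ∀ x y j → (x ⊛ y) j ≡ ∑ (λ i → x i *F y (rotate (toℕ i) j))
    ⊛-sum x y j = ≡.refl

    ·V-⊛ : ∀ a x y → ((a ·V x) ⊛ y) ≈V (a ·V (x ⊛ y))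
    ·V-⊛ a x y j = F.trans
      (Sum.sum-cong (λ i → a *F x i *F y (rotate (toℕ i) j)) (λ i → a *F (x i *F y (rotate (toℕ i) j))) (λ i → F.*-assoc _ _ _))
      (F.sym (Sum.*-distribˡ-sum a (λ i → x i *F y (rotate (toℕ i) j))))

  algebra : CommutativeRing 0ℓ 0ℓ
  algebra = record
    { Carrier = V ; _≈_ = _≈V_ ; _+_ = _+V_ ; _*_ = _⊛_ ; -_ = λ x i → F.- x i ; 0# = 0V ; 1# = one
    ; isCommutativeRing = record
      { isRing = record
        { +-isAbelianGroup = record
          { isGroup = record
            { isMonoid = record
              { isSemigroup = record
                { isMagma = record
                  { isEquivalence = record
                    { refl = λ _ → F.refl ; sym = λ eq i → F.sym (eq i) ; trans = λ eq₁ eq₂ i → F.trans (eq₁ i) (eq₂ i) }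
                  ; ∙-cong = λ eq₁ eq₂ i → F.+-cong (eq₁ i) (eq₂ i) }
                ; assoc = λ x y z i → F.+-assoc _ _ _ }
              ; identity = (λ x i → F.+-identityˡ _) , (λ x i → F.+-identityʳ _) }
            ; inverse = (λ x i → F.-‿inverseˡ _) , (λ x i → F.-‿inverseʳ _)
            ; ⁻¹-cong = λ eq i → F.-‿cong (eq i) }
          ; comm = λ x y i → F.+-comm _ _ }
        ; *-cong = ⊛-cong
        ; *-assoc = ⊛-assoc
        ; *-identity = (λ x j → F.trans (⊛-comm one x j) (⊛-identityʳ x j)) , ⊛-identityʳ
        ; distrib = ⊛-distribˡ , λ x y z j → F.trans (⊛-comm (y +V z) x j)
            (F.trans (⊛-distribˡ x y z j) (F.+-cong (⊛-comm x y j) (⊛-comm x z j))) }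
      ; *-comm = ⊛-comm } }

  open CommutativeRing algebra public hiding (zero; -_)
  open import Algebra.Properties.Semiring.Mult semiring using () renaming (_×_ to _⋆_)
  open import Algebra.Properties.Semiring.Mult F.semiring using () renaming (_×_ to _⋆F_)
  open import Algebra.Properties.CommutativeSemiring.Exp commutativeSemiring using (_^_; ^-congˡ; ^-congʳ; ^-assocʳ; ^-distrib-*)
  open import Algebra.Properties.CommutativeSemiring.Exp F.commutativeSemiring using () renaming (_^_ to _^F_)
  open Sums algebra using (sum) renaming (sum-cong to sumR-cong)
  module RR where
    open import Relation.Binary.Reasoning.Setoid setoid public

  X : V
  X = σ one

  X* : ∀ x → (X * x) ≈ σ x
  X* x j = F.trans (⊛-rotateˡ one x 1 j) (*-identityˡ x (cpred j))

  X^* : ∀ k x → (X ^ k * x) ≈ (x ∘ rotate k)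
  X^* zero    x = *-identityˡ x
  X^* (suc k) x j = F.trans (*-assoc X (X ^ k) x j) (F.trans (X* (X ^ k * x) j) (X^* k x (cpred j)))

  X^n≈1 : X ^ n ≈ 1#
  X^n≈1 j = F.trans (F.sym (*-identityʳ (X ^ n) j)) (F.trans (X^* n 1# j) (F.reflexive (≡.cong one (rotate-n j))))

  constant : K → V
  constant a = a ·V one

  constant-* : ∀ a x → (constant a * x) ≈ (a ·V x)
  constant-* a x j = F.trans (·V-⊛ a one x j) (F.*-congˡ (*-identityˡ x j))

  constant-^ : ∀ a k → constant a ^ k ≈ constant (a ^F k)
  constant-^ a zero    j = F.sym (F.*-identityˡ _)
  constant-^ a (suc k) j = F.trans (*-congˡ {constant a} (constant-^ a k) j) (F.trans (constant-* a (constant (a ^F k)) j) (F.sym (F.*-assoc _ _ _)))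

  sum-pointwise : ∀ {m} (f : Fin m → V) j → sum f j ≡ ∑ (λ i → f i j)
  sum-pointwise {zero}  f j = ≡.refl
  sum-pointwise {suc m} f j = ≡.cong (f zero j +F_) (sum-pointwise (f ∘ suc) j)

  expand : ∀ x → x ≈ sum (λ i → constant (x i) * X ^ toℕ i)
  expand x j = F.sym (begin
    sum (λ i → constant (x i) * X ^ toℕ i) j ≡⟨ sum-pointwise (λ i → constant (x i) * X ^ toℕ i) j ⟩
    ∑ (λ i → (constant (x i) * X ^ toℕ i) j) ≈⟨ Sum.sum-cong (λ i → (constant (x i) * X ^ toℕ i) j) (λ i → x i *F one (rotate (toℕ i) j))
      (λ i → F.trans (constant-* (x i) (X ^ toℕ i) j) (F.*-congˡ (F.trans (F.sym (*-identityʳ (X ^ toℕ i) j)) (X^* (toℕ i) 1# j)))) ⟩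
    ∑ (λ i → x i *F one (rotate (toℕ i) j)) ≡⟨ ⊛-sum x one j ⟨
    (x ⊛ one) j ≈⟨ ⊛-identityʳ x j ⟩
    x j ∎)

  vanish : ∀ (k : Fin (suc r)) z → (q C suc (toℕ k)) ⋆ z ≈ 0#
  vanish k z j = F.trans (F.reflexive (pointwise (q C suc (toℕ k)))) (FieldProperties.binomial-vanishes F k (z j))
    where
    pointwise : ∀ m → (m ⋆ z) j ≡ m ⋆F z j
    pointwise zero    = ≡.refl
    pointwise (suc m) = ≡.cong (z j +F_) (pointwise m)

  open Frobenius algebra r

  frobenius-+ : ∀ k (x y : V) → (x + y) ^ (q ℕ.^ k) ≈ x ^ (q ℕ.^ k) + y ^ (q ℕ.^ k)
  frobenius-+ = ^q^-+ vanish

  scale-^ : ∀ a x k → (a ·V x) ^ (q ℕ.^ k) ≈ (a ·V (x ^ (q ℕ.^ k)))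
  scale-^ a x k = RR.begin
    (a ·V x) ^ Q            RR.≈⟨ ^-congˡ Q (constant-* a x) ⟨
    (constant a * x) ^ Q    RR.≈⟨ ^-distrib-* (constant a) x Q ⟩
    constant a ^ Q * x ^ Q  RR.≈⟨ *-congʳ {x ^ Q} (constant-^ a Q) ⟩
    constant (a ^F Q) * x ^ Q RR.≈⟨ constant-* (a ^F Q) (x ^ Q) ⟩
    ((a ^F Q) ·V (x ^ Q))    RR.≈⟨ (λ j → F.*-congʳ (FieldProperties.fermat-^ F k a)) ⟩
    (a ·V (x ^ Q))          RR.∎
    where Q = q ℕ.^ k

  frobenius-sum : ∀ k {m} (f : Fin m → V) → sum f ^ (q ℕ.^ k) ≈ sum (λ i → f i ^ (q ℕ.^ k))
  frobenius-sum zero f = trans (*-identityʳ (sum f)) (sumR-cong f _ (λ i → sym (*-identityʳ (f i))))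
  frobenius-sum (suc k) f = RR.begin
    sum f ^ (q ℕ.* Q)             RR.≈⟨ ^-assocʳ (sum f) q Q ⟨
    (sum f ^ q) ^ Q               RR.≈⟨ ^-congˡ Q (^q-sum vanish f) ⟩
    sum (λ i → f i ^ q) ^ Q       RR.≈⟨ frobenius-sum k (λ i → f i ^ q) ⟩
    sum (λ i → (f i ^ q) ^ Q)     RR.≈⟨ sumR-cong (λ i → (f i ^ q) ^ Q) (λ i → f i ^ (q ℕ.* Q)) (λ i → ^-assocʳ (f i) q Q) ⟩
    sum (λ i → f i ^ (q ℕ.* Q))   RR.∎
    where Q = q ℕ.^ k

  -- For x = f(X) this is f(X)^Q = f(X^Q): Q-th powers are additive and fix the coefficients. It
  -- serves twice, for the period q^N of the algebra and for evaluating f at the conjugates of X.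
  expand-^ : ∀ k x → x ^ (q ℕ.^ k) ≈ sum (λ i → constant (x i) * (X ^ (q ℕ.^ k)) ^ toℕ i)
  expand-^ k x = RR.begin
    x ^ Q                                               RR.≈⟨ ^-congˡ Q (expand x) ⟩
    sum (λ i → constant (x i) * X ^ toℕ i) ^ Q          RR.≈⟨ frobenius-sum k (λ i → constant (x i) * X ^ toℕ i) ⟩
    sum (λ i → (constant (x i) * X ^ toℕ i) ^ Q)        RR.≈⟨ sumR-cong (λ i → (constant (x i) * X ^ toℕ i) ^ Q)
      (λ i → constant (x i) * (X ^ Q) ^ toℕ i) (λ i → RR.begin
        (constant (x i) * X ^ toℕ i) ^ Q        RR.≈⟨ ^-distrib-* (constant (x i)) (X ^ toℕ i) Q ⟩
        constant (x i) ^ Q * (X ^ toℕ i) ^ Q    RR.≈⟨ *-cong (constant-^ (x i) Q) (^-assocʳ X (toℕ i) Q) ⟩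
        constant (x i ^F Q) * X ^ (toℕ i ℕ.* Q) RR.≈⟨ *-cong {constant (x i ^F Q)} {constant (x i)} (λ j → F.*-congʳ (FieldProperties.fermat-^ F k (x i)))
                                                      (^-congʳ X (ℕ.*-comm (toℕ i) Q)) ⟩
        constant (x i) * X ^ (Q ℕ.* toℕ i)      RR.≈⟨ *-congˡ {constant (x i)} (^-assocʳ X Q (toℕ i)) ⟨
        constant (x i) * (X ^ Q) ^ toℕ i        RR.∎) ⟩
    sum (λ i → constant (x i) * (X ^ Q) ^ toℕ i)        RR.∎
    where Q = q ℕ.^ k

-- Quotients by annihilators, and rings in which x^m = x.

module Localisation (R : CommutativeRing 0ℓ 0ℓ) (e : CommutativeRing.Carrier R) where
  open CommutativeRing R hiding (zero)
  open import Algebra.Solver.Ring.NaturalCoefficients.Default commutativeSemiring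
    using (solve; _:*_; _:=_)
  open import Relation.Binary.Reasoning.Setoid setoid
  open import Algebra.Properties.Ring ring using (-‿distribʳ-*)

  infix 4 _≈ₑ_
  -- Equality modulo the annihilator of e. The carrier and the operations stay those of R, so the
  -- quotient map is the identity; e itself need not be idempotent.
  _≈ₑ_ : Carrier → Carrier → Set
  x ≈ₑ y = e * x ≈ e * y

  *-congₑ : ∀ {x x′ y y′} → x ≈ₑ x′ → y ≈ₑ y′ → x * y ≈ₑ x′ * y′
  *-congₑ {x} {x′} {y} {y′} x≈x′ y≈y′ = begin
    e * (x * y)    ≈⟨ *-assoc _ _ _ ⟨
    e * x * y      ≈⟨ *-congʳ x≈x′ ⟩
    e * x′ * y     ≈⟨ solve 3 (λ e x y → e :* x :* y := x :* (e :* y)) refl e x′ y ⟩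
    x′ * (e * y)   ≈⟨ *-congˡ y≈y′ ⟩
    x′ * (e * y′)  ≈⟨ solve 3 (λ e x y → x :* (e :* y) := e :* (x :* y)) refl e x′ y′ ⟩
    e * (x′ * y′)  ∎

  localisation : CommutativeRing 0ℓ 0ℓ
  localisation = record
    { Carrier = Carrier ; _≈_ = _≈ₑ_ ; _+_ = _+_ ; _*_ = _*_ ; -_ = -_ ; 0# = 0# ; 1# = 1#
    ; isCommutativeRing = record
      { isRing = record
        { +-isAbelianGroup = record
          { isGroup = record
            { isMonoid = record
              { isSemigroup = record
                { isMagma = record
                  { isEquivalence = record { refl = refl ; sym = sym ; trans = trans }
                  ; ∙-cong = λ x≈x′ y≈y′ → trans (distribˡ _ _ _) (trans (+-cong x≈x′ y≈y′) (sym (distribˡ _ _ _))) }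
                ; assoc = λ x y z → *-congˡ (+-assoc x y z) }
              ; identity = (λ x → *-congˡ (+-identityˡ x)) , (λ x → *-congˡ (+-identityʳ x)) }
            ; inverse = (λ x → *-congˡ (-‿inverseˡ x)) , (λ x → *-congˡ (-‿inverseʳ x))
            ; ⁻¹-cong = λ x≈y → trans (sym (-‿distribʳ-* _ _)) (trans (-‿cong x≈y) (-‿distribʳ-* _ _)) }
          ; comm = λ x y → *-congˡ (+-comm x y) }
        ; *-cong = *-congₑ
        ; *-assoc = λ x y z → *-congˡ (*-assoc x y z)
        ; *-identity = (λ x → *-congˡ (*-identityˡ x)) , (λ x → *-congˡ (*-identityʳ x))
        ; distrib = (λ x y z → *-congˡ (distribˡ x y z)) , (λ x y z → *-congˡ (distribʳ x y z)) }
      ; *-comm = λ x y → *-congˡ (*-comm x y) } }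

HasPeriod : CommutativeRing 0ℓ 0ℓ → ℕ → Set
HasPeriod R m = ∀ x → x ^ m ≈ x
  where
  open CommutativeRing R
  open Exp semiring using (_^_)

module Reduced (R : CommutativeRing 0ℓ 0ℓ) (s : ℕ) (pow : HasPeriod R (2 ℕ.+ s))
  (_≟_ : Decidable (CommutativeRing._≈_ R)) where

  open CommutativeRing R hiding (zero)
  open Exp semiring using (_^_)
  open import Algebra.Solver.Ring.NaturalCoefficients.Default commutativeSemiring
    using (solve; _:*_; _:=_)
  open import Relation.Binary.Reasoning.Setoid setoid

  private
    pow-idem : ∀ x → x ^ suc s * x ^ suc s ≈ x ^ suc s
    pow-idem x = begin
      x * x ^ s * x ^ suc s  ≈⟨ solve 3 (λ a b c → a :* b :* c := a :* c :* b) refl x (x ^ s) (x ^ suc s) ⟩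
      x * x ^ suc s * x ^ s  ≈⟨ *-congʳ (pow x) ⟩
      x * x ^ s              ∎

  -- In the quotient, x is either zero or a unit with inverse `x ^ s`.
  Dichotomy : Carrier → Carrier → Set
  Dichotomy e x = (e * x ≈ 0#) ⊎ (e * x ^ suc s ≈ e)

  private
    multiple-dichotomy : ∀ e x z → Dichotomy e x → Dichotomy (e * z) x
    multiple-dichotomy e x z (inj₁ ex≈0) = inj₁ (begin
      e * z * x    ≈⟨ solve 3 (λ a b c → a :* b :* c := a :* c :* b) refl e z x ⟩
      e * x * z    ≈⟨ *-congʳ ex≈0 ⟩
      0# * z       ≈⟨ zeroˡ z ⟩
      0#           ∎)
    multiple-dichotomy e x z (inj₂ exˢ≈e) = inj₂ (begin
      e * z * x ^ suc s  ≈⟨ solve 3 (λ a b c → a :* b :* c := a :* c :* b) refl e z (x ^ suc s) ⟩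
      e * x ^ suc s * z  ≈⟨ *-congʳ exˢ≈e ⟩
      e * z              ∎)

  -- x ^ suc s is the idempotent supported where x is nonzero; intersecting successively with those
  -- of all x leaves an e whose localisation is a field.
  atom : ∀ {m} (f : Fin m → Carrier) y → ¬ y ≈ 0# →
    ∃ λ e → (∃ λ w → e ≈ y * w) × (¬ e ≈ 0#) × (∀ i → Dichotomy e (f i))
  atom {zero} f y y≉0 = y , (1# , sym (*-identityʳ y)) , y≉0 , λ ()
  atom {suc m} f y y≉0 with atom (f ∘ suc) y y≉0
  ... | e , (w , e≈yw) , e≉0 , dich with (e * f zero) ≟ 0#
  ...   | yes ef≈0 = e , (w , e≈yw) , e≉0 , λ { zero → inj₁ ef≈0 ; (suc i) → dich i }
  ...   | no ef≉0  = e * x ^ suc s , (w * x ^ suc s , trans (*-congʳ e≈yw) (*-assoc _ _ _)) , e′≉0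
    , λ { zero → inj₂ (trans (*-assoc _ _ _) (*-congˡ (pow-idem x)))
        ; (suc i) → multiple-dichotomy e (f (suc i)) (x ^ suc s) (dich i) }
    where
    x = f zero
    e′≉0 : ¬ e * x ^ suc s ≈ 0#
    e′≉0 eq = ef≉0 (begin
      e * x                ≈⟨ *-congˡ (pow x) ⟨
      e * (x * x ^ suc s)  ≈⟨ solve 3 (λ a b c → a :* (b :* c) := a :* c :* b) refl e x (x ^ suc s) ⟩
      e * x ^ suc s * x    ≈⟨ *-congʳ eq ⟩
      0# * x               ≈⟨ zeroˡ x ⟩
      0#                   ∎)

  -- The period makes R reduced: g = g g^(s+1), so e = g v equals e g times g^s.
  multiple-annihilated : ∀ e g v → e ≈ g * v → e * g ≈ 0# → e ≈ 0#
  multiple-annihilated e g v e≈gv eg≈0 = begin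
    e                      ≈⟨ e≈gv ⟩
    g * v                  ≈⟨ *-congʳ (pow g) ⟨
    g * g ^ suc s * v      ≈⟨ solve 3 (λ a b c → a :* b :* c := a :* c :* b) refl g (g ^ suc s) v ⟩
    g * v * (g * g ^ s)    ≈⟨ *-congʳ e≈gv ⟨
    e * (g * g ^ s)        ≈⟨ *-assoc _ _ _ ⟨
    e * g * g ^ s          ≈⟨ *-congʳ eg≈0 ⟩
    0# * g ^ s             ≈⟨ zeroˡ _ ⟩
    0#                     ∎

  -- Order exactly n is recorded only through the exponents n/p for primes p, because this is what a
  -- common multiple of the X^(n/p) - 1 delivers.
  record FieldIdempotent (n : ℕ) (X : Carrier) : Set where
    field
      X^n≈1      : X ^ n ≈ 1#
      e          : Carrier
      e≉0        : ¬ e ≈ 0#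
      dichotomy  : ∀ x → Dichotomy e x
      X^[n∕p]≉1  : ∀ p c → Prime p → n ≡ c ℕ.* p → ¬ e * X ^ c ≈ e * 1#

  module Cancel (e : Carrier) (dich : ∀ x → Dichotomy e x) where
    open Localisation R e

    cancelₑ : NoZeroDivisors localisation
    cancelₑ x y x≉0 xy≈0 with dich x
    ... | inj₁ ex≈0 = contradiction (trans ex≈0 (sym (zeroʳ e))) x≉0
    ... | inj₂ exˢ≈e = begin
      e * y                    ≈⟨ *-congʳ exˢ≈e ⟨
      e * (x * x ^ s) * y      ≈⟨ solve 4 (λ e x z y → e :* (x :* z) :* y := e :* (x :* y) :* z) refl e x (x ^ s) y ⟩
      e * (x * y) * x ^ s      ≈⟨ *-congʳ xy≈0 ⟩
      e * 0# * x ^ s           ≈⟨ *-congʳ (zeroʳ e) ⟩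
      0# * x ^ s               ≈⟨ zeroˡ _ ⟩
      0#                       ≈⟨ zeroʳ e ⟨
      e * 0#                   ∎

-- A nonzero common multiple of the X^(n/p) - 1.

module PrimitiveElement {r} (F : FiniteField (2 ℕ.+ r)) (n′ : ℕ) where
  open CyclicAlgebra F n′
  private
    n = suc n′
    module RF = FieldProperties F
  open CommutativeRing algebra using (-_)
  open import Algebra.Properties.CommutativeSemiring.Exp commutativeSemiring using (_^_)
  open Space F n using (V)
  open +-*-Solver using () renaming (solve to solveℕ; _:*_ to _:*ℕ_; _:=_ to _:=ℕ_)

  cofactor : ℕ → V
  cofactor c = X ^ c + - 1#

  cofactor-* : ∀ c y j → F._≈_ ((cofactor c * y) j) (y (rotate c j) F.+ F.- y j)
  cofactor-* c y j = F.trans (distribʳ y (X ^ c) (- 1#) j) (F.+-cong (X^* c y j)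
    (F.trans (F.sym (-‿distribˡ-* 1# y j)) (F.-‿cong (*-identityˡ y j))))
    where open import Algebra.Properties.Ring ring using (-‿distribˡ-*)

  -- D is the product of the primes p already treated: the product y of the X^(n/p) - 1 is supported
  -- on the subgroup of exponents killed by D, which contains no n/p for a new prime p.
  Product : ℕ → Set
  Product t = ∃ λ (y : V) → ∃ λ D →
    (∀ j → ¬ F._≈_ (y j) F.0# → n ∣ toℕ j ℕ.* D) ×
    (¬ F._≈_ (y zero) F.0#) ×
    (∀ p → Prime p → p ∣ D → p ℕ.≤ t) ×
    (∀ p c → Prime p → p ℕ.≤ t → n ≡ c ℕ.* p → ∃ λ w → y ≈ cofactor c * w)

  productZero : Product 0
  productZero = 1# , 1 , support , RF.1≉0 , bound , λ p c pr p≤0 _ →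
    contradiction (≡.subst Prime (ℕ.n≤0⇒n≡0 p≤0) pr) ¬prime[0]
    where
    support : ∀ j → ¬ F._≈_ (one j) F.0# → n ∣ toℕ j ℕ.* 1
    support zero    _ = n ℕ.∣0
    support (suc j) ¬0 = contradiction F.refl ¬0
    bound : ∀ p → Prime p → p ∣ 1 → p ℕ.≤ 0
    bound p pr p∣1 = contradiction (ℕ.∣1⇒≡1 p∣1) (ℕ.nonTrivial⇒≢1 {{prime⇒nonTrivial pr}})

  -- The new coefficient at j is y(j - c) - y(j), where c = n/p. If it is nonzero, n divides j D or
  -- (j - c) D; multiplied by p, and with c p = n, either gives n | j D p. At j = 0 the term y(-c)
  -- is zero: otherwise c p = n would divide c D, so p would divide D, whose prime factors are all
  -- at most t. So the coefficient at 0 is -y(0).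
  productStep : ∀ t c → Prime (suc t) → n ≡ c ℕ.* suc t → Product t → Product (suc t)
  productStep t c pr n≡cp (y , D , support , y₀≉0 , bound , multiple) =
    cofactor c * y , D ℕ.* p , support′ , y′₀≉0 , bound′ , multiple′
    where
    p = suc t
    n∣rotated : ∀ j → n ∣ toℕ (rotate c j) ℕ.* D → n ∣ toℕ j ℕ.* (D ℕ.* p)
    n∣rotated j n∣ with rotate-toℕ c j
    ... | k , eq = ℕ.∣m+n∣m⇒∣n
      (≡.subst (n ∣_) (≡.sym (≡.trans (≡.sym (ℕ.*-distribʳ-+ (D ℕ.* p) (k ℕ.* n) (toℕ j)))
          (≡.trans (≡.cong (ℕ._* (D ℕ.* p)) (≡.trans (ℕ.+-comm (k ℕ.* n) (toℕ j)) (≡.sym eq))) (ℕ.*-distribʳ-+ (D ℕ.* p) (toℕ (rotate c j)) c))))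
        (ℕ.∣m∣n⇒∣m+n
          (≡.subst (n ∣_) (ℕ.*-assoc (toℕ (rotate c j)) D p) (ℕ.∣m⇒∣m*n p n∣))
          (divides D (≡.trans (solveℕ 3 (λ c D p → c :*ℕ (D :*ℕ p) :=ℕ D :*ℕ (c :*ℕ p)) ≡.refl c D p)
             (≡.cong (D ℕ.*_) (≡.sym n≡cp))))))
      (ℕ.∣m⇒∣m*n (D ℕ.* p) (ℕ.n∣m*n k))
    support′ : ∀ j → ¬ F._≈_ ((cofactor c * y) j) F.0# → n ∣ toℕ j ℕ.* (D ℕ.* p)
    support′ j nz with F._≟_ (y j) F.0# | F._≟_ (y (rotate c j)) F.0#
    ... | no yj≉0   | _ = ≡.subst (n ∣_) (ℕ.*-assoc (toℕ j) D p) (ℕ.∣m⇒∣m*n p (support j yj≉0))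
    ... | yes yj≈0  | no yr≉0  = n∣rotated j (support (rotate c j) yr≉0)
    ... | yes yj≈0  | yes yr≈0 = contradiction
      (F.trans (cofactor-* c y j) (F.trans (F.+-cong yr≈0 (F.-‿cong yj≈0)) (F.-‿inverseʳ F.0#))) nz
    c≢0 : ℕ.NonZero c
    c≢0 = ℕ.≢-nonZero λ { ≡.refl → contradiction n≡cp λ () }
    p∤D : ¬ p ∣ D
    p∤D p∣D = ℕ.1+n≰n (bound p pr p∣D)
    y-rotated : F._≈_ (y (rotate c zero)) F.0#
    y-rotated with F._≟_ (y (rotate c zero)) F.0#
    ... | yes eq = eq
    ... | no nz with rotate-toℕ c zero
    ...   | k , eq = contradiction (ℕ.*-cancelˡ-∣ c {{c≢0}} (≡.subst (_∣ c ℕ.* D) n≡cp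
        (ℕ.∣m+n∣m⇒∣n (≡.subst (n ∣_) (ℕ.*-distribʳ-+ D (toℕ (rotate c zero)) c)
          (ℕ.∣m⇒∣m*n D (≡.subst (n ∣_) (≡.sym eq) (ℕ.n∣m*n k)))) (support (rotate c zero) nz)))) p∤D
    y′₀≉0 : ¬ F._≈_ ((cofactor c * y) zero) F.0#
    y′₀≉0 eq = y₀≉0 (x-y≈0⇒y≈x (F.trans (F.sym (F.trans (cofactor-* c y zero) (F.+-congʳ y-rotated))) eq))
      where
      open import Algebra.Properties.Group F.+-group using (x∙y⁻¹≈ε⇒x≈y)
      x-y≈0⇒y≈x : F._≈_ (F.0# F.+ F.- y zero) F.0# → F._≈_ (y zero) F.0#
      x-y≈0⇒y≈x eq = F.sym (x∙y⁻¹≈ε⇒x≈y _ _ eq)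
    bound′ : ∀ p′ → Prime p′ → p′ ∣ D ℕ.* p → p′ ℕ.≤ p
    bound′ p′ pr′ p′∣ with euclidsLemma D p pr′ p′∣
    ... | inj₁ p′∣D = ℕ.m≤n⇒m≤1+n (bound p′ pr′ p′∣D)
    ... | inj₂ p′∣p = ℕ.∣⇒≤ p′∣p
    multiple′ : ∀ p′ c′ → Prime p′ → p′ ℕ.≤ p → n ≡ c′ ℕ.* p′ → ∃ λ w → cofactor c * y ≈ cofactor c′ * w
    multiple′ p′ c′ pr′ p′≤p n≡c′p′ with p′ ℕ.≟ p
    ... | yes ≡.refl rewrite ℕ.*-cancelʳ-≡ c c′ p (≡.trans (≡.sym n≡cp) n≡c′p′) = y , refl
    ... | no p′≢p with multiple p′ c′ pr′ (ℕ.≤-pred (ℕ.≤∧≢⇒< p′≤p p′≢p)) n≡c′p′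
    ...   | w , y≈ = cofactor c * w , trans (*-congˡ {cofactor c} y≈)
      (trans (sym (*-assoc (cofactor c) (cofactor c′) w)) (trans (*-congʳ {w} (*-comm (cofactor c) (cofactor c′)))
        (*-assoc (cofactor c′) (cofactor c) w)))

  productSkip : ∀ t → ¬ (Prime (suc t) × suc t ∣ n) → Product t → Product (suc t)
  productSkip t skip (y , D , support , y₀≉0 , bound , multiple) =
    y , D , support , y₀≉0 , (λ p pr p∣D → ℕ.m≤n⇒m≤1+n (bound p pr p∣D)) , multiple′
    where
    multiple′ : ∀ p c → Prime p → p ℕ.≤ suc t → n ≡ c ℕ.* p → ∃ λ w → y ≈ cofactor c * w
    multiple′ p c pr p≤ n≡cp with p ℕ.≟ suc t
    ... | yes ≡.refl = contradiction (pr , divides c n≡cp) skip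
    ... | no p≢      = multiple p c pr (ℕ.≤-pred (ℕ.≤∧≢⇒< p≤ p≢)) n≡cp

  product : ∀ t → Product t
  product zero    = productZero
  product (suc t) with prime? (suc t) | suc t ∣? n
  ... | yes pr | yes (divides c n≡cp) = productStep t c pr n≡cp (product t)
  ... | yes pr | no ∤n = productSkip t (∤n ∘ proj₂) (product t)
  ... | no ¬pr | _     = productSkip t (¬pr ∘ proj₁) (product t)

-- Arithmetic of geometric sums and of powers of q modulo n.

module Arithmetic where
  open import Data.Nat
  open import Data.Nat.Properties
  open import Data.Nat.Divisibility
  open import Relation.Binary.PropositionalEquality
  open +-*-Solver

  geomSum-* : ∀ q k d {A} → q ^ k ≡ suc A → suc (geomSum q k d * A) ≡ q ^ (k * suc d)
  geomSum-* q k zero {A} q^k≡ = trans (cong suc (+-identityʳ A)) (trans (sym q^k≡) (cong (q ^_) (sym (*-identityʳ k))))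
  geomSum-* q k (suc d) {A} q^k≡ = begin
    suc ((geomSum q k d + Q) * A)       ≡⟨ cong suc (*-distribʳ-+ A (geomSum q k d) Q) ⟩
    suc (geomSum q k d * A) + Q * A     ≡⟨ cong (_+ Q * A) (geomSum-* q k d q^k≡) ⟩
    Q + Q * A                           ≡⟨ *-suc Q A ⟨
    Q * suc A                           ≡⟨ cong (Q *_) q^k≡ ⟨
    q ^ (k * suc d) * q ^ k             ≡⟨ ^-distribˡ-+-* q (k * suc d) k ⟨
    q ^ (k * suc d + k)                 ≡⟨ cong (q ^_) (trans (+-comm (k * suc d) k) (sym (*-suc k (suc d)))) ⟩
    q ^ (k * suc (suc d))               ∎
    where
    open ≡-Reasoning
    Q = q ^ (k * suc d)

  geomSum-positive : ∀ q k d → 1 ≤ geomSum q k d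
  geomSum-positive q k zero    = ≤-refl
  geomSum-positive q k (suc d) = m≤n⇒m≤n+o _ (geomSum-positive q k d)

  geomSum-mod : ∀ q k d {A} → q ^ k ≡ suc A → ∃ λ c → geomSum q k d ≡ suc d + c * A
  geomSum-mod q k zero q^k≡ = 0 , refl
  geomSum-mod q k (suc d) {A} q^k≡ with geomSum-mod q k d q^k≡
  ... | c , eq = c + geomSum q k d , (begin
    geomSum q k d + q ^ (k * suc d)        ≡⟨ cong₂ _+_ eq (sym (geomSum-* q k d q^k≡)) ⟩
    suc d + c * A + suc (geomSum q k d * A) ≡⟨ solve 4 (λ d c g A → con 1 :+ d :+ c :* A :+ (con 1 :+ g :* A) :=
       con 2 :+ d :+ (c :+ g) :* A) refl d c (geomSum q k d) A ⟩
    suc (suc d) + (c + geomSum q k d) * A  ∎)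
    where open ≡-Reasoning

  geomSum-coprime : ∀ q k d {A} → q ^ k ≡ suc A → gcd (d + 1) A ≡ 1 → Coprime (geomSum q k d) A
  geomSum-coprime q k d {A} q^k≡ gcd≡1 {g} (g∣n , g∣A) with geomSum-mod q k d q^k≡
  ... | c , eq = ∣1⇒≡1 (subst (g ∣_) gcd≡1 (gcd-greatest g∣d+1 g∣A))
    where
    g∣d+1 : g ∣ d + 1
    g∣d+1 = subst (g ∣_) (+-comm 1 d) (∣m+n∣m⇒∣n (subst (g ∣_) (trans eq (+-comm (suc d) _)) g∣n) (∣n⇒∣m*n c g∣A))

  ^-cancelʳ-≤ : ∀ q {m n} → 1 < q → q ^ m ≤ q ^ n → m ≤ n
  ^-cancelʳ-≤ q {m} {n} 1<q le = ≮⇒≥ λ n<m → <⇒≱ (^-monoʳ-< q 1<q n<m) le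

  -- Compare after multiplying by q^k - 1, which is `suc A`: n (q^k - 1) is less than q^k q^(kd),
  -- and q^k ≤ q (q^k - 1) since q ≥ 2.
  geomSum-bound : ∀ q k d {A} → 1 < q → q ^ k ≡ suc (suc A) → ∀ c → q ^ c ≤ geomSum q k d → c ≤ k * d
  geomSum-bound q k d {A} 1<q q^k≡ c q^c≤n = ≮⇒≥ λ kd<c → <-irrefl refl (begin-strict
    geomSum q k d * suc A          <⟨ n<1+n _ ⟩
    suc (geomSum q k d * suc A)    ≡⟨ geomSum-* q k d q^k≡ ⟩
    q ^ (k * suc d)                ≡⟨ cong (q ^_) (*-suc k d) ⟩
    q ^ (k + k * d)                ≡⟨ ^-distribˡ-+-* q k (k * d) ⟩
    q ^ k * q ^ (k * d)            ≡⟨ cong (_* q ^ (k * d)) q^k≡ ⟩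
    (2 + A) * q ^ (k * d)          ≤⟨ *-monoˡ-≤ (q ^ (k * d)) 2+A≤ ⟩
    suc A * q * q ^ (k * d)        ≡⟨ *-assoc (suc A) q _ ⟩
    suc A * q ^ suc (k * d)        ≡⟨ *-comm (suc A) _ ⟩
    q ^ suc (k * d) * suc A        ≤⟨ *-monoˡ-≤ (suc A) (^-monoʳ-≤ q {{>-nonZero (<⇒≤ 1<q)}} kd<c) ⟩
    q ^ c * suc A                  ≤⟨ *-monoˡ-≤ (suc A) q^c≤n ⟩
    geomSum q k d * suc A          ∎)
    where
    open ≤-Reasoning
    2+A≤ : 2 + A ≤ suc A * q
    2+A≤ = begin
      2 + A              ≤⟨ +-monoʳ-≤ 2 (m≤m+n A (A + 0)) ⟩
      2 + 2 * A          ≡⟨ solve 1 (λ A → con 2 :+ con 2 :* A := (con 1 :+ A) :* con 2) refl A ⟩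
      suc A * 2          ≤⟨ *-monoʳ-≤ (suc A) 1<q ⟩
      suc A * q          ∎

  m<q^m : ∀ q m → 1 < q → m < q ^ m
  m<q^m q zero    1<q = s≤s z≤n
  m<q^m q (suc m) 1<q = begin-strict
    suc m         ≡⟨ +-comm 1 m ⟩
    m + 1         <⟨ +-mono-<-≤ (m<q^m q m 1<q) (≤-trans (s≤s z≤n) (m<q^m q m 1<q)) ⟩
    q ^ m + q ^ m ≡⟨ solve 1 (λ x → x :+ x := con 2 :* x) refl (q ^ m) ⟩
    2 * q ^ m     ≤⟨ *-monoˡ-≤ (q ^ m) 1<q ⟩
    q * q ^ m     ∎
    where open ≤-Reasoning

  2m≤q^m : ∀ q m → 1 < q → m + m ≤ q ^ m
  2m≤q^m q zero    1<q = z≤n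
  2m≤q^m q (suc m) 1<q = begin
    suc m + suc m  ≡⟨ solve 1 (λ x → x :+ x := con 2 :* x) refl (suc m) ⟩
    2 * suc m      ≤⟨ *-mono-≤ 1<q (m<q^m q m 1<q) ⟩
    q * q ^ m      ∎
    where open ≤-Reasoning

  -- In other words q has order k + M modulo n. Multiplying by q^(N-i), which inverts q^i modulo n,
  -- leaves n | q^s - 1. For s ≤ M this is too small, because 0 < q^s - 1 < n. For larger s the
  -- complement t = N - s is at most k ≤ M, and q^t is 1 modulo n as well.
  powers-distinct : ∀ q n A k M → 1 < q → q ^ (k + M) ≡ suc (n * A) → k ≤ M → q ^ M < n →
    ∀ i s → 0 < s → i + s < k + M → ¬ n ∣ q ^ (i + s) ∸ q ^ i
  powers-distinct q n A k M 1<q q^N≡ k≤M q^M<n i s 0<s i+s<N n∣ = excluded (s ≤? M)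
    where
    N = k + M
    instance
      q≢0 : NonZero q
      q≢0 = >-nonZero (<⇒≤ 1<q)
    less1 : ℕ → ℕ
    less1 t = q ^ t ∸ 1
    q^t≡ : ∀ t → q ^ t ≡ suc (less1 t)
    q^t≡ t = sym (m+[n∸m]≡n (m^n>0 q t))
    too-small : ∀ t → 0 < t → t ≤ M → ¬ n ∣ less1 t
    too-small t 0<t t≤M n∣ = <⇒≱ (begin-strict
      less1 t     <⟨ n<1+n _ ⟩
      suc (less1 t) ≡⟨ q^t≡ t ⟨
      q ^ t      ≤⟨ ^-monoʳ-≤ q t≤M ⟩
      q ^ M      <⟨ q^M<n ⟩
      n          ∎) (∣⇒≤ {{>-nonZero positive}} n∣)
      where
      open ≤-Reasoning
      positive : 0 < less1 t
      positive = m<n⇒0<n∸m (≤-trans 1<q (≤-trans (≤-reflexive (sym (*-identityʳ q))) (^-monoʳ-≤ q 0<t)))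
    i≤N : i ≤ N
    i≤N = ≤-trans (m≤m+n i s) (<⇒≤ i+s<N)
    n∣qˢ-1 : n ∣ less1 s
    n∣qˢ-1 = ∣m+n∣m⇒∣n (subst (n ∣_) eq (∣n⇒∣m*n (q ^ (N ∸ i)) n∣)) (∣m⇒∣m*n (less1 s) (m∣m*n A))
      where
      open ≡-Reasoning
      eq : q ^ (N ∸ i) * (q ^ (i + s) ∸ q ^ i) ≡ n * A * less1 s + less1 s
      eq = begin
        q ^ (N ∸ i) * (q ^ (i + s) ∸ q ^ i)      ≡⟨ cong (λ z → q ^ (N ∸ i) * (z ∸ q ^ i)) (^-distribˡ-+-* q i s) ⟩
        q ^ (N ∸ i) * (q ^ i * q ^ s ∸ q ^ i)    ≡⟨ cong (λ z → q ^ (N ∸ i) * (q ^ i * q ^ s ∸ z)) (*-identityʳ (q ^ i)) ⟨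
        q ^ (N ∸ i) * (q ^ i * q ^ s ∸ q ^ i * 1) ≡⟨ cong (q ^ (N ∸ i) *_) (*-distribˡ-∸ (q ^ i) (q ^ s) 1) ⟨
        q ^ (N ∸ i) * (q ^ i * less1 s)           ≡⟨ *-assoc (q ^ (N ∸ i)) (q ^ i) (less1 s) ⟨
        q ^ (N ∸ i) * q ^ i * less1 s             ≡⟨ cong (_* less1 s) (^-distribˡ-+-* q (N ∸ i) i) ⟨
        q ^ (N ∸ i + i) * less1 s                 ≡⟨ cong (λ z → q ^ z * less1 s) (m∸n+n≡m i≤N) ⟩
        q ^ N * less1 s                           ≡⟨ cong (_* less1 s) q^N≡ ⟩
        less1 s + n * A * less1 s                  ≡⟨ +-comm (less1 s) _ ⟩
        n * A * less1 s + less1 s                  ∎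
    s<N : s < N
    s<N = ≤-<-trans (m≤n+m s i) i+s<N
    excluded : ¬ Dec (s ≤ M)
    excluded (yes s≤M) = too-small s 0<s s≤M n∣qˢ-1
    excluded (no s≰M) = too-small t (m<n⇒0<n∸m s<N) (≤-trans t≤k k≤M)
      (∣m+n∣m⇒∣n (subst (n ∣_) eq (m∣m*n A)) (∣m⇒∣m*n (q ^ t) n∣qˢ-1))
      where
      t = N ∸ s
      t≤k : t ≤ k
      t≤k = ≤-trans (∸-monoʳ-≤ N (≰⇒≥ s≰M)) (≤-reflexive (m+n∸n≡m k M))
      open ≡-Reasoning
      eq : n * A ≡ less1 s * q ^ t + less1 t
      eq = suc-injective (begin
        suc (n * A)                   ≡⟨ q^N≡ ⟨
        q ^ N                         ≡⟨ cong (q ^_) (m+[n∸m]≡n (<⇒≤ s<N)) ⟨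
        q ^ (s + t)                   ≡⟨ ^-distribˡ-+-* q s t ⟩
        q ^ s * q ^ t                 ≡⟨ cong (_* q ^ t) (q^t≡ s) ⟩
        q ^ t + less1 s * q ^ t        ≡⟨ cong (_+ less1 s * q ^ t) (q^t≡ t) ⟩
        suc (less1 t + less1 s * q ^ t) ≡⟨ cong suc (+-comm (less1 t) _) ⟩
        suc (less1 s * q ^ t + less1 t) ∎)

  -- Bézout's identity serves here for exponents, which cannot be negative; a multiple of the
  -- product, harmless as an exponent of units of E, makes both coefficients natural numbers.
  crt-one : ∀ n A → Coprime (suc n) (suc A) → ∃₂ λ a b → ∃ λ c → a * suc n + b * suc A ≡ 1 + c * (suc n * suc A)
  crt-one n A coprime with coprime-Bézout coprime
  ... | Bézout.+- x y eq = x , y * n , y , (begin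
    x * suc n + y * n * suc A            ≡⟨ cong (_+ y * n * suc A) eq ⟨
    1 + y * suc A + y * n * suc A        ≡⟨ solve 3 (λ n A y → con 1 :+ y :* (con 1 :+ A) :+ y :* n :* (con 1 :+ A) :=
                                             con 1 :+ y :* ((con 1 :+ n) :* (con 1 :+ A))) refl n A y ⟩
    1 + y * (suc n * suc A)              ∎)
    where open ≡-Reasoning
  ... | Bézout.-+ x y eq = x * A , y , x , (begin
    x * A * suc n + y * suc A            ≡⟨ cong (x * A * suc n +_) eq ⟨
    x * A * suc n + (1 + x * suc n)      ≡⟨ solve 3 (λ n A x → x :* A :* (con 1 :+ n) :+ (con 1 :+ x :* (con 1 :+ n)) :=
                                             con 1 :+ x :* ((con 1 :+ n) :* (con 1 :+ A))) refl n A x ⟩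
    1 + x * (suc n * suc A)              ∎)
    where open ≡-Reasoning

open Arithmetic

-- Lists the elements of a quotient without forming it; the elements of L will be counted as such
-- representatives.
transversal : ∀ {A : Set} {_~_ : A → A → Set} {P : A → Set} →
  (∀ x y → Dec (x ~ y)) → (∀ x → Dec (P x)) → (∀ x → x ~ x) → (∀ {x y} → x ~ y → y ~ x) →
  ∀ {m} (f : Fin m → A) → ∃ λ s → ∃ λ (g : Fin s → A) →
    (∀ i j → g i ~ g j → i ≡ j) × (∀ i → P (g i)) × (∀ j → P (f j) → ∃ λ i → g i ~ f j)
transversal _~?_ P? ~-refl ~-sym {zero} f = 0 , (λ ()) , (λ ()) , (λ ()) , λ ()
transversal _~?_ P? ~-refl ~-sym {suc m} f with transversal _~?_ P? ~-refl ~-sym (f ∘ suc) | P? (f zero)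
... | s , g , g-inj , Pg , complete | no ¬Pf = s , g , g-inj , Pg ,
  λ { zero Pf → contradiction Pf ¬Pf ; (suc j) → complete j }
... | s , g , g-inj , Pg , complete | yes Pf with Fin.any? (λ i → g i ~? f zero)
...   | yes found = s , g , g-inj , Pg , λ { zero _ → found ; (suc j) → complete j }
...   | no new    = suc s , (λ { zero → f zero ; (suc i) → g i }) ,
  (λ { zero zero _ → ≡.refl
     ; zero (suc j) eq → contradiction (j , ~-sym eq) new
     ; (suc i) zero eq → contradiction (i , eq) new
     ; (suc i) (suc j) eq → ≡.cong suc (g-inj i j eq) }) ,
  (λ { zero → Pf ; (suc i) → Pg i }) ,
  λ { zero _ → zero , ~-refl (f zero)
    ; (suc j) Pfj → let i , eq = complete j Pfj in suc i , eq }

prime-factor : ∀ t → 1 ℕ.< t → ∃ λ p → Prime p × p ∣ t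
prime-factor t 1<t with factorise t {{ℕ.>-nonZero (ℕ.<⇒≤ 1<t)}}
... | record { factors = [] ; isFactorisation = eq } = contradiction (≡.sym eq) (ℕ.<⇒≢ 1<t)
... | record { factors = p ∷ ps ; isFactorisation = eq ; factorsPrime = pr ∷ _ } =
  p , pr , divides (productℕ ps) (≡.trans eq (ℕ.*-comm p _))

-- Construction of the element e.

module CyclicField {r} (F : FiniteField (2 ℕ.+ r)) (n′ k M A : ℕ)
  (q^k≡ : (2 ℕ.+ r) ℕ.^ k ≡ 2 ℕ.+ A)
  (q^N≡ : (2 ℕ.+ r) ℕ.^ (k ℕ.+ M) ≡ suc (suc n′ ℕ.* suc A)) where

  open CyclicAlgebra F n′
  open PrimitiveElement F n′
  open CommutativeRing algebra using (-_)
  open import Algebra.Properties.CommutativeSemiring.Exp commutativeSemiring using (_^_; ^-congˡ; ^-congʳ; ^-assocʳ)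
  open Sums algebra using (sum) renaming (sum-cong to sumR-cong)
  open UnitPowers algebra

  -- `suc S` computes to `n * suc A`, which is q^N - 1, so that `suc (suc S)` is the period in the
  -- shape that `Reduced` expects.
  q n N Q S : ℕ
  q = 2 ℕ.+ r
  n = suc n′
  N = k ℕ.+ M
  Q = q ℕ.^ k
  S = A ℕ.+ n′ ℕ.* suc A

  X^q^N≈X : X ^ (q ℕ.^ N) ≈ X
  X^q^N≈X = trans (^-congʳ X q^N≡) (trans (*-congˡ {X} (trans (sym (^-assocʳ X n (suc A)))
    (trans (^-congˡ (suc A) X^n≈1) (1^ (suc A))))) (*-identityʳ X))

  -- By `expand-^` the power replaces X by X^(q^N), and this is X because n divides q^N - 1.
  pow : ∀ x → x * x ^ suc S ≈ x
  pow x = RR.begin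
    x ^ suc (suc S)                                     RR.≈⟨ ^-congʳ x q^N≡ ⟨
    x ^ (q ℕ.^ N)                                       RR.≈⟨ expand-^ N x ⟩
    sum (λ i → constant (x i) * (X ^ (q ℕ.^ N)) ^ toℕ i) RR.≈⟨ sumR-cong (λ i → constant (x i) * (X ^ (q ℕ.^ N)) ^ toℕ i)
      (λ i → constant (x i) * X ^ toℕ i) (λ i → *-congˡ {constant (x i)} (^-congˡ (toℕ i) X^q^N≈X)) ⟩
    sum (λ i → constant (x i) * X ^ toℕ i)              RR.≈⟨ expand x ⟨
    x                                                   RR.∎

  _≟V_ : ∀ x y → Dec (x ≈ y)
  x ≟V y = Fin.all? λ i → F._≟_ (x i) (y i)

  open Reduced algebra S pow _≟V_
  open FieldProperties F using (decode; code; decode-code)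

  Idempotent : Set
  Idempotent = FieldIdempotent n X

  private
    multiple-atom : ∀ y → (∀ p c → Prime p → n ≡ c ℕ.* p → ∃ λ w → y ≈ cofactor c * w) →
      (∃ λ e → (∃ λ v → e ≈ y * v) × (¬ e ≈ 0#) × (∀ i → Dichotomy e (decode n i))) → Idempotent
    multiple-atom y multiple (e , (v , e≈yv) , e≉0 , dich) = record
      { X^n≈1 = X^n≈1 ; e = e ; e≉0 = e≉0 ; dichotomy = λ x → transfer x (dich (code x)) ; X^[n∕p]≉1 = X^c≉1 }
      where
      transfer : ∀ x → Dichotomy e (decode n (code x)) → Dichotomy e x
      transfer x (inj₁ ed≈0) = inj₁ (trans (*-congˡ {e} {x} {decode n (code x)} (λ j → F.sym (decode-code x j))) ed≈0)
      transfer x (inj₂ ed≈e) = inj₂ (trans (*-congˡ {e} {x ^ suc S} {decode n (code x) ^ suc S}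
        (^-congˡ (suc S) {x} {decode n (code x)} (λ j → F.sym (decode-code x j)))) ed≈e)
      -- If X^c were 1 in the quotient, e would annihilate X^c - 1, of which it is a multiple.
      X^c≉1 : ∀ p c → Prime p → n ≡ c ℕ.* p → ¬ e * X ^ c ≈ e * 1#
      X^c≉1 p c pr n≡cp eX^c≈e = let w , y≈gw = multiple p c pr n≡cp in
        e≉0 (multiple-annihilated e (cofactor c) (w * v)
        (trans e≈yv (trans (*-congʳ {v} {y} {cofactor c * w} y≈gw) (*-assoc (cofactor c) w v)))
        (RR.begin
          e * (X ^ c + - 1#)         RR.≈⟨ distribˡ e (X ^ c) (- 1#) ⟩
          e * X ^ c + e * - 1#       RR.≈⟨ +-congʳ {e * - 1#} eX^c≈e ⟩
          e * 1# + e * - 1#          RR.≈⟨ distribˡ e 1# (- 1#) ⟨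
          e * (1# + - 1#)            RR.≈⟨ *-congˡ {e} (-‿inverseʳ 1#) ⟩
          e * 0#                     RR.≈⟨ zeroʳ e ⟩
          0#                         RR.∎))

    from-product : Product n → Idempotent
    from-product (y , _ , _ , y₀≉0 , _ , multiple) = multiple-atom y
      (λ p c pr n≡cp → multiple p c pr (ℕ.∣⇒≤ (divides c n≡cp)) n≡cp)
      (atom (decode n) y (λ y≈0 → y₀≉0 (y≈0 zero)))

  idempotent : Idempotent
  idempotent = from-product (product n)

-- The field E: order of X, roots of unity, fixed elements, conjugates.

module ResidueField (R : CommutativeRing 0ℓ 0ℓ) (_≟R_ : Decidable (CommutativeRing._≈_ R)) (n′ A : ℕ)
  (pow : HasPeriod R (suc (suc n′ ℕ.* suc A))) (X : CommutativeRing.Carrier R)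
  (idem : Reduced.FieldIdempotent R (A ℕ.+ n′ ℕ.* suc A) pow _≟R_ (suc n′) X) where

  open CommutativeRing R hiding (zero)
  open Exp semiring using (_^_)
  open import Algebra.Properties.CommutativeSemiring.Exp commutativeSemiring using (^-congˡ; ^-congʳ; ^-assocʳ; ^-homo-*)
  open Sums R using (sum; sum-cong; sum-truncate)
  open UnitPowers R
  open Reduced R (A ℕ.+ n′ ℕ.* suc A) pow _≟R_
  open FieldIdempotent idem
  open Localisation R e
  private
    n = suc n′

  X^[mn]≈1 : ∀ m → X ^ (m ℕ.* n) ≈ 1#
  X^[mn]≈1 m = trans (^-congʳ X (ℕ.*-comm m n)) (trans (sym (^-assocʳ X n m)) (trans (^-congˡ m X^n≈1) (1^ m)))

  open Cancel e dichotomy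
  module E = CommutativeRing localisation
  module ER where
    open import Relation.Binary.Reasoning.Setoid E.setoid public
  module ERoots = Roots localisation cancelₑ

  _≟ₑ_ : ∀ x y → Dec (x ≈ₑ y)
  x ≟ₑ y = (e * x) ≟R (e * y)

  lift : ∀ {x y} → x ≈ y → x ≈ₑ y
  lift = *-congˡ {e}

  ^-same : ∀ x m → Exp._^_ E.semiring x m ≡ x ^ m
  ^-same x zero    = ≡.refl
  ^-same x (suc m) = ≡.cong (x *_) (^-same x m)

  ^-congₑ : ∀ {x y} m → x ≈ₑ y → x ^ m ≈ₑ y ^ m
  ^-congₑ zero    x≈y = refl
  ^-congₑ {x} {y} (suc m) x≈y = *-congₑ {x} {y} {x ^ m} {y ^ m} x≈y (^-congₑ m x≈y)

  1≉ₑ0 : ¬ 1# ≈ₑ 0#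
  1≉ₑ0 1≈0 = e≉0 (trans (sym (*-identityʳ e)) (trans 1≈0 (zeroʳ e)))

  ^-cycle : ∀ {x} m l → x ^ m ≈ₑ 1# → x ^ (l ℕ.* m) ≈ₑ 1#
  ^-cycle {x} m l eq = ER.begin
    x ^ (l ℕ.* m)    ER.≈⟨ lift (^-congʳ x (ℕ.*-comm l m)) ⟩
    x ^ (m ℕ.* l)    ER.≈⟨ lift (^-assocʳ x m l) ⟨
    (x ^ m) ^ l      ER.≈⟨ ^-congₑ l eq ⟩
    1# ^ l           ER.≈⟨ lift (1^ l) ⟩
    1#               ER.∎

  -- Bézout would give X^g = 1 for g = gcd(m, n), a proper divisor of n. For a prime p dividing n/g,
  -- the exponent n/p is a multiple of g, so X^(n/p) = 1 in E, which is excluded.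
  order-< : ∀ m → 0 ℕ.< m → m ℕ.< n → ¬ X ^ m ≈ₑ 1#
  order-< m 0<m m<n X^m≈1 with gcd[m,n]∣n m n
  ... | divides t n≡tg with prime-factor t 1<t
    where
    g<n : gcd m n ℕ.< n
    g<n = ℕ.≤-<-trans (ℕ.∣⇒≤ {{ℕ.>-nonZero 0<m}} (gcd[m,n]∣m m n)) m<n
    1<t : 1 ℕ.< t
    1<t = ℕ.≰⇒> λ t≤1 → ℕ.<⇒≱ g<n (ℕ.≤-trans (ℕ.≤-reflexive n≡tg)
      (ℕ.≤-trans (ℕ.*-monoˡ-≤ (gcd m n) t≤1) (ℕ.≤-reflexive (ℕ.*-identityˡ _))))
  ...   | p , pr , divides u t≡up = X^[n∕p]≉1 p (u ℕ.* g) pr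
      (≡.trans n≡tg (≡.trans (≡.cong (ℕ._* g) t≡up) (≡.trans (ℕ.*-assoc u p g)
        (≡.trans (≡.cong (u ℕ.*_) (ℕ.*-comm p g)) (≡.sym (ℕ.*-assoc u g p))))))
      (^-cycle g u X^g≈1)
    where
    g = gcd m n
    X^g≈1 : X ^ g ≈ₑ 1#
    X^g≈1 with Bézout.identity (gcd-GCD m n)
    ... | Bézout.+- a b eq = ER.begin
      X ^ g                     ER.≈⟨ lift (*-identityʳ (X ^ g)) ⟨
      X ^ g * 1#                ER.≈⟨ lift (*-congˡ {X ^ g} (X^[mn]≈1 b)) ⟨
      X ^ g * X ^ (b ℕ.* n)     ER.≈⟨ lift (^-homo-* X g (b ℕ.* n)) ⟨
      X ^ (g ℕ.+ b ℕ.* n)       ER.≈⟨ lift (^-congʳ X eq) ⟩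
      X ^ (a ℕ.* m)             ER.≈⟨ ^-cycle m a X^m≈1 ⟩
      1#                        ER.∎
    ... | Bézout.-+ a b eq = ER.begin
      X ^ g                     ER.≈⟨ lift (*-identityʳ (X ^ g)) ⟨
      X ^ g * 1#                ER.≈⟨ E.*-congˡ {X ^ g} {X ^ (a ℕ.* m)} {1#} (^-cycle m a X^m≈1) ⟨
      X ^ g * X ^ (a ℕ.* m)     ER.≈⟨ lift (^-homo-* X g (a ℕ.* m)) ⟨
      X ^ (g ℕ.+ a ℕ.* m)       ER.≈⟨ lift (^-congʳ X eq) ⟩
      X ^ (b ℕ.* n)             ER.≈⟨ lift (X^[mn]≈1 b) ⟩
      1#                        ER.∎

  order : ∀ m → X ^ m ≈ₑ 1# → n ∣ m
  order m X^m≈1 with m % n ℕ.≟ 0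
  ... | yes eq = ℕ.m%n≡0⇒n∣m m n eq
  ... | no ≢0  = contradiction (ER.begin
    X ^ (m % n)                             ER.≈⟨ lift (*-identityʳ (X ^ (m % n))) ⟨
    X ^ (m % n) * 1#                        ER.≈⟨ lift (*-congˡ {X ^ (m % n)} (X^[mn]≈1 (m / n))) ⟨
    X ^ (m % n) * X ^ (m / n ℕ.* n)         ER.≈⟨ lift (^-homo-* X (m % n) (m / n ℕ.* n)) ⟨
    X ^ (m % n ℕ.+ m / n ℕ.* n)             ER.≈⟨ lift (^-congʳ X (m≡m%n+[m/n]*n m n)) ⟨
    X ^ m                                   ER.≈⟨ X^m≈1 ⟩
    1#                                      ER.∎) (order-< (m % n) (ℕ.n≢0⇒n>0 ≢0) (m%n<n m n))

  -- X^i cancels through its inverse `X ^ (i * n′)`, since X^(i n) = 1.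
  order-∸ : ∀ i j → i ℕ.≤ j → X ^ i ≈ₑ X ^ j → n ∣ j ∸ i
  order-∸ i j i≤j eq = order (j ∸ i) (ER.begin
    X ^ (j ∸ i)                                ER.≈⟨ lift (*-identityˡ (X ^ (j ∸ i))) ⟨
    1# * X ^ (j ∸ i)                           ER.≈⟨ lift (*-congʳ {X ^ (j ∸ i)} (X^[mn]≈1 i)) ⟨
    X ^ (i ℕ.* n) * X ^ (j ∸ i)                ER.≈⟨ lift (^-homo-* X (i ℕ.* n) (j ∸ i)) ⟨
    X ^ (i ℕ.* n ℕ.+ (j ∸ i))                  ER.≈⟨ lift (^-congʳ X exponent) ⟩
    X ^ (i ℕ.* n′ ℕ.+ j)                       ER.≈⟨ lift (^-homo-* X (i ℕ.* n′) j) ⟩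
    X ^ (i ℕ.* n′) * X ^ j                     ER.≈⟨ E.*-congˡ {X ^ (i ℕ.* n′)} {X ^ i} {X ^ j} eq ⟨
    X ^ (i ℕ.* n′) * X ^ i                     ER.≈⟨ lift (^-homo-* X (i ℕ.* n′) i) ⟨
    X ^ (i ℕ.* n′ ℕ.+ i)                       ER.≈⟨ lift (^-congʳ X (≡.trans (ℕ.+-comm _ i) (≡.sym (ℕ.*-suc i n′)))) ⟩
    X ^ (i ℕ.* n)                              ER.≈⟨ lift (X^[mn]≈1 i) ⟩
    1#                                         ER.∎)
    where
    exponent : i ℕ.* n ℕ.+ (j ∸ i) ≡ i ℕ.* n′ ℕ.+ j
    exponent = ≡.trans (≡.cong (ℕ._+ (j ∸ i)) (≡.trans (ℕ.*-suc i n′) (ℕ.+-comm i _)))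
      (≡.trans (ℕ.+-assoc (i ℕ.* n′) i (j ∸ i)) (≡.cong (i ℕ.* n′ ℕ.+_) (ℕ.m+[n∸m]≡n i≤j)))

  private
    small : ∀ {m} → n ∣ m → m ℕ.< n → m ≡ 0
    small {zero}  n∣ m<n = ≡.refl
    small {suc m} n∣ m<n = contradiction (ℕ.∣⇒≤ n∣) (ℕ.<⇒≱ m<n)
    ordered : ∀ (i j : Fin n) → toℕ i ℕ.≤ toℕ j → X ^ toℕ i ≈ₑ X ^ toℕ j → i ≡ j
    ordered i j i≤j eq = Fin.toℕ-injective (ℕ.≤-antisym i≤j (ℕ.m∸n≡0⇒m≤n
      (small (order-∸ (toℕ i) (toℕ j) i≤j eq) (ℕ.≤-<-trans (ℕ.m∸n≤m (toℕ j) (toℕ i)) (Fin.toℕ<n j)))))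

  powers-injective : ∀ (i j : Fin n) → X ^ toℕ i ≈ₑ X ^ toℕ j → i ≡ j
  powers-injective i j eq with ℕ.≤-total (toℕ i) (toℕ j)
  ... | inj₁ i≤j = ordered i j i≤j eq
  ... | inj₂ j≤i = ≡.sym (ordered j i j≤i (sym eq))

  private
    ^E-cong : ∀ {x y} a b → x ^ a ≈ₑ y ^ b → Exp._^_ E.semiring x a ≈ₑ Exp._^_ E.semiring y b
    ^E-cong {x} {y} a b = ≡.subst₂ _≈ₑ_ (≡.sym (^-same x a)) (≡.sym (^-same y b))

  -- The n powers of X are distinct roots of T^n - 1; a root outside this list would be one too
  -- many.
  roots-of-unity : ∀ z → z ^ n ≈ₑ 1# → ∃ λ (i : Fin n) → z ≈ₑ X ^ toℕ i
  roots-of-unity z z^n≈1 with Fin.any? (λ (i : Fin n) → z ≟ₑ (X ^ toℕ i))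
  ... | yes found = found
  ... | no missing = contradiction root (ERoots.binomial-roots (fromℕ n) zero (λ ()) 1≉ₑ0 r r-injective)
    where
    r : Fin (suc n) → Carrier
    r zero    = z
    r (suc i) = X ^ toℕ i
    r-injective : ∀ i j → r i ≈ₑ r j → i ≡ j
    r-injective zero    zero    eq = ≡.refl
    r-injective zero    (suc j) eq = contradiction (j , eq) missing
    r-injective (suc i) zero    eq = contradiction (i , sym eq) missing
    r-injective (suc i) (suc j) eq = ≡.cong suc (powers-injective i j eq)
    r^n≈1 : ∀ i → r i ^ n ≈ₑ 1#
    r^n≈1 zero    = z^n≈1
    r^n≈1 (suc i) = lift (trans (^-assocʳ X (toℕ i) n) (X^[mn]≈1 (toℕ i)))
    root : ∀ i → Exp._^_ E.semiring (r i) (toℕ (fromℕ n)) ≈ₑ 1#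
    root i = ≡.subst (λ m → Exp._^_ E.semiring (r i) m ≈ₑ 1#) (≡.sym (Fin.toℕ-fromℕ n)) (^E-cong {r i} {r i} n 0 (r^n≈1 i))

  -- The nonzero elements have exponent n (A + 1), so for coprime n and A + 1 each of them is a
  -- product of an n-th and an (A + 1)-st root of unity.
  decompose : Coprime n (suc A) → ∀ x → ¬ x ≈ₑ 0# →
    ∃ λ (i : Fin n) → ∃ λ y → (x ≈ₑ X ^ toℕ i * y) × (y ^ (2 ℕ.+ A) ≈ₑ y)
  decompose coprime x x≉0 with crt-one n′ A coprime | dichotomy x
  ... | a , b , c , eq | inj₁ ex≈0 = contradiction (trans ex≈0 (sym (zeroʳ e))) x≉0
  ... | a , b , c , eq | inj₂ exˢ≈e with roots-of-unity (x ^ (b ℕ.* suc A)) z^n≈1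
    where
    x^[nA]≈1 : x ^ (n ℕ.* suc A) ≈ₑ 1#
    x^[nA]≈1 = trans exˢ≈e (sym (*-identityʳ e))
    z^n≈1 : (x ^ (b ℕ.* suc A)) ^ n ≈ₑ 1#
    z^n≈1 = ER.begin
      (x ^ (b ℕ.* suc A)) ^ n        ER.≈⟨ lift (^-assocʳ x (b ℕ.* suc A) n) ⟩
      x ^ (b ℕ.* suc A ℕ.* n)        ER.≈⟨ lift (^-congʳ x (≡.trans (ℕ.*-assoc b (suc A) n) (≡.cong (b ℕ.*_) (ℕ.*-comm (suc A) n)))) ⟩
      x ^ (b ℕ.* (n ℕ.* suc A))      ER.≈⟨ ^-cycle (n ℕ.* suc A) b x^[nA]≈1 ⟩
      1#                             ER.∎
  -- The relation from `crt-one` splits x as x^(a n) x^(b (A + 1)). The second factor is the n-th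
  -- root of unity; the first has exponent A + 1, so its (A + 2)-nd power is itself.
  ...   | i , z≈X^i = i , x ^ (a ℕ.* n) , x≈ , (ER.begin
      y * y ^ suc A                  ER.≈⟨ E.*-congˡ {y} y^A≈1 ⟩
      y * 1#                         ER.≈⟨ lift (*-identityʳ y) ⟩
      y                              ER.∎)
    where
    y = x ^ (a ℕ.* n)
    x^[nA]≈1 : x ^ (n ℕ.* suc A) ≈ₑ 1#
    x^[nA]≈1 = trans exˢ≈e (sym (*-identityʳ e))
    y^A≈1 : y ^ suc A ≈ₑ 1#
    y^A≈1 = ER.begin
      y ^ suc A                      ER.≈⟨ lift (^-assocʳ x (a ℕ.* n) (suc A)) ⟩
      x ^ (a ℕ.* n ℕ.* suc A)        ER.≈⟨ lift (^-congʳ x (ℕ.*-assoc a n (suc A))) ⟩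
      x ^ (a ℕ.* (n ℕ.* suc A))      ER.≈⟨ ^-cycle (n ℕ.* suc A) a x^[nA]≈1 ⟩
      1#                             ER.∎
    x≈ : x ≈ₑ X ^ toℕ i * y
    x≈ = ER.begin
      x                                       ER.≈⟨ lift (*-identityʳ x) ⟨
      x * 1#                                  ER.≈⟨ E.*-congˡ {x} (^-cycle (n ℕ.* suc A) c x^[nA]≈1) ⟨
      x ^ suc (c ℕ.* (n ℕ.* suc A))           ER.≈⟨ lift (^-congʳ x eq) ⟨
      x ^ (a ℕ.* n ℕ.+ b ℕ.* suc A)           ER.≈⟨ lift (^-homo-* x (a ℕ.* n) (b ℕ.* suc A)) ⟩
      y * x ^ (b ℕ.* suc A)                   ER.≈⟨ E.*-congˡ {y} z≈X^i ⟩
      y * X ^ toℕ i                           ER.≈⟨ lift (*-comm y (X ^ toℕ i)) ⟩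
      X ^ toℕ i * y                           ER.∎

  -- Q + 1 distinct fixed elements would be too many roots of T^Q - T.
  fixed-bound : ∀ {s} (r : Fin s → Carrier) → (∀ i j → r i ≈ₑ r j → i ≡ j) →
    (∀ i → r i ^ (2 ℕ.+ A) ≈ₑ r i) → s ℕ.≤ 2 ℕ.+ A
  fixed-bound {s} r r-injective fixed = ℕ.≮⇒≥ λ Q<s →
    ERoots.binomial-roots {suc Q} (fromℕ Q) (suc zero) (λ ()) 1≉ₑ0 (λ i → r (inject≤ i Q<s))
      (λ i j eq → Fin.inject≤-injective Q<s Q<s i j (r-injective _ _ eq))
      λ i → ≡.subst (λ m → Exp._^_ E.semiring (r (inject≤ i Q<s)) m ≈ₑ Exp._^_ E.semiring (r (inject≤ i Q<s)) 1) (≡.sym (Fin.toℕ-fromℕ Q))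
        (^E-cong {r (inject≤ i Q<s)} {r (inject≤ i Q<s)} Q 1 (E.trans {r (inject≤ i Q<s) ^ Q} (fixed (inject≤ i Q<s)) (lift (sym (*-identityʳ (r (inject≤ i Q<s)))))))
    where Q = 2 ℕ.+ A

  -- If x = f(X) is zero in E, so are its powers x^(q^j) = f(X^(q^j)). When the coefficients from N
  -- on vanish, f has only N coefficients but the N distinct roots X^(q^j), j < N.
  independent : ∀ q N (N≤n : N ℕ.≤ n) → (∀ i s → 0 ℕ.< s → i ℕ.+ s ℕ.< N → ¬ n ∣ q ℕ.^ (i ℕ.+ s) ∸ q ℕ.^ i) → 1 ℕ.< q →
    ∀ x (c : Fin n → Carrier) → (∀ j → x ^ (q ℕ.^ j) ≈ sum (λ i → c i * (X ^ (q ℕ.^ j)) ^ toℕ i)) →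
    x ≈ₑ 0# → (∀ i → N ℕ.≤ toℕ i → c i ≈ 0#) → ∀ i → c (inject≤ i N≤n) ≈ₑ 0#
  independent q N N≤n distinct 1<q x c conjugates x≈0 high = ERoots.vanishing-coefficients
      (λ i → c (inject≤ i N≤n)) (λ j → X ^ (q ℕ.^ toℕ j)) r-injective root
    where
    instance
      q≢0 : ℕ.NonZero q
      q≢0 = ℕ.>-nonZero (ℕ.<⇒≤ 1<q)
    separated : ∀ (i j : Fin N) → toℕ i ℕ.< toℕ j → ¬ X ^ (q ℕ.^ toℕ i) ≈ₑ X ^ (q ℕ.^ toℕ j)
    separated i j i<j eq = distinct (toℕ i) (toℕ j ∸ toℕ i) (ℕ.m<n⇒0<n∸m i<j)
      (≡.subst (ℕ._< N) (≡.sym j≡) (Fin.toℕ<n j))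
      (≡.subst (λ m → n ∣ q ℕ.^ m ∸ q ℕ.^ toℕ i) (≡.sym j≡) (order-∸ _ _ (ℕ.^-monoʳ-≤ q (ℕ.<⇒≤ i<j)) eq))
      where
      j≡ : toℕ i ℕ.+ (toℕ j ∸ toℕ i) ≡ toℕ j
      j≡ = ℕ.m+[n∸m]≡n (ℕ.<⇒≤ i<j)
    r-injective : ∀ (i j : Fin N) → X ^ (q ℕ.^ toℕ i) ≈ₑ X ^ (q ℕ.^ toℕ j) → i ≡ j
    r-injective i j eq with ℕ.<-cmp (toℕ i) (toℕ j)
    ... | tri< i<j _ _ = contradiction eq (separated i j i<j)
    ... | tri≈ _ i≡j _ = Fin.toℕ-injective i≡j
    ... | tri> _ _ i>j = contradiction (sym eq) (separated j i i>j)
    root : ∀ j → ERoots.eval (λ i → c (inject≤ i N≤n)) (X ^ (q ℕ.^ toℕ j)) ≈ₑ 0#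
    root j = ER.begin
      sum (λ i → c (inject≤ i N≤n) * Exp._^_ E.semiring α (toℕ i))
        ER.≈⟨ lift (sum-cong (λ i → c (inject≤ i N≤n) * Exp._^_ E.semiring α (toℕ i)) (λ i → c (inject≤ i N≤n) * α ^ toℕ (inject≤ i N≤n))
          λ i → *-congˡ (reflexive (≡.trans (^-same α (toℕ i)) (≡.cong (α ^_) (≡.sym (Fin.toℕ-inject≤ i N≤n)))))) ⟩
      sum (λ i → c (inject≤ i N≤n) * α ^ toℕ (inject≤ i N≤n))
        ER.≈⟨ lift (sum-truncate N≤n (λ i → c i * α ^ toℕ i) λ i N≤i → trans (*-congʳ (high i N≤i)) (zeroˡ _)) ⟨
      sum (λ i → c i * α ^ toℕ i)    ER.≈⟨ lift (conjugates (toℕ j)) ⟨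
      x ^ (q ℕ.^ toℕ j)              ER.≈⟨ ^-congₑ (q ℕ.^ toℕ j) x≈0 ⟩
      0# ^ (q ℕ.^ toℕ j)             ER.≈⟨ lift (0^ (q ℕ.^ toℕ j) (ℕ.m^n>0 q (toℕ j))) ⟩
      0#                             ER.∎
      where
      α = X ^ (q ℕ.^ toℕ j)
      0^ : ∀ m → 0 ℕ.< m → 0# ^ m ≈ 0#
      0^ (suc m) _ = zeroˡ (0# ^ m)

-- The subspace U: covering and dimension.

module FixedSubspace {r} (F : FiniteField (2 ℕ.+ r)) (n′ k M A : ℕ)
  (q^k≡ : (2 ℕ.+ r) ℕ.^ k ≡ 2 ℕ.+ A)
  (q^N≡ : (2 ℕ.+ r) ℕ.^ (k ℕ.+ M) ≡ suc (suc n′ ℕ.* suc A))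
  (idem : CyclicField.Idempotent F n′ k M A q^k≡ q^N≡) where

  open CyclicAlgebra F n′
  open CyclicField F n′ k M A q^k≡ q^N≡
  open Reduced.FieldIdempotent idem using (e; e≉0)
  open CommutativeRing algebra using (-_)
  open Space F (suc n′) using (V; _·V_; Subspace; CyclicallyCovering; HasDim; _∈U)
  open LinearAlgebra F using (dim-bound)
  open FieldProperties F using (decode; code; decode-code; code-injective; cancel)
  open import Algebra.Properties.CommutativeSemiring.Exp commutativeSemiring using (_^_; ^-congˡ; ^-congʳ)
  open ResidueField algebra _≟V_ n′ A pow X idem
  open Localisation algebra e

  ^Q : ∀ x → x ^ Q ≈ x ^ (2 ℕ.+ A)
  ^Q x = ^-congʳ x q^k≡

  0^Q : 0# ^ Q ≈ 0#
  0^Q = trans (^Q 0#) (zeroˡ (0# ^ suc A))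

  U : Subspace
  U = record
    { _∈U      = λ u → u ^ Q ≈ₑ u
    ; resp     = λ {u} {v} u≈v u∈ → E.trans {v ^ Q} {u ^ Q} {v} (lift (^-congˡ Q (sym u≈v))) (E.trans {u ^ Q} {u} {v} u∈ (lift u≈v))
    ; zero∈    = lift 0^Q
    ; +-closed = λ {u} {v} u∈ v∈ → E.trans {(u + v) ^ Q} {u ^ Q + v ^ Q} {u + v} (lift (frobenius-+ k u v)) (E.+-cong {u ^ Q} {u} {v ^ Q} {v} u∈ v∈)
    ; ·-closed = λ a {v} v∈ → ER.begin
        (a ·V v) ^ Q          ER.≈⟨ lift (scale-^ a v k) ⟩
        (a ·V (v ^ Q))        ER.≈⟨ lift (constant-* a (v ^ Q)) ⟨
        constant a * v ^ Q    ER.≈⟨ E.*-congˡ {constant a} {v ^ Q} {v} v∈ ⟩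
        constant a * v        ER.≈⟨ lift (constant-* a v) ⟩
        (a ·V v)              ER.∎
    }

  U? : ∀ u → Dec (u ^ Q ≈ₑ u)
  U? u = (u ^ Q) ≟ₑ u

  U-resp : ∀ {u v} → u ≈ₑ v → v ^ Q ≈ₑ v → u ^ Q ≈ₑ u
  U-resp {u} {v} u≈v v∈ = E.trans {u ^ Q} {v ^ Q} {u} (^-congₑ Q u≈v) (E.trans {v ^ Q} {v} {u} v∈ (sym u≈v))

  private
    -- Covering asks for an equality in Fⁿ, while the decomposition of x holds only in E. So u is x
    -- itself shifted back, X^(n-i) x. It agrees with y in E, and membership in U depends only on
    -- the class in E.
    shift-into-U : ∀ x (i : Fin n) y → x ≈ₑ X ^ toℕ i * y → y ^ (2 ℕ.+ A) ≈ₑ y →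
      Σ V λ u → (u ^ Q ≈ₑ u) × (x ≈ Space.σ^ F n (toℕ i) u)
    shift-into-U x i y x≈X^iy y-fixed = u , U-resp {u} {y} u≈y (E.trans {y ^ Q} {y ^ (2 ℕ.+ A)} {y} (lift (^Q y)) y-fixed) , x≈σu
      where
      open import Algebra.Properties.CommutativeSemiring.Exp commutativeSemiring using (^-homo-*)
      u : V
      u j = x (rotate (n ∸ toℕ i) j)
      i≤n = ℕ.<⇒≤ (Fin.toℕ<n i)
      x≈σu : x ≈ Space.σ^ F n (toℕ i) u
      x≈σu j = F.reflexive (≡.sym (≡.trans (σ^-rotate (toℕ i) u j) (≡.cong x (≡.trans (rotate-+ (n ∸ toℕ i) (toℕ i) j)
        (≡.trans (≡.cong (λ m → rotate m j) (ℕ.m+[n∸m]≡n i≤n)) (rotate-n j))))))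
      u≈y : u ≈ₑ y
      u≈y = ER.begin
        u                                       ER.≈⟨ lift (X^* (n ∸ toℕ i) x) ⟨
        X ^ (n ∸ toℕ i) * x                     ER.≈⟨ E.*-congˡ {X ^ (n ∸ toℕ i)} {x} {X ^ toℕ i * y} x≈X^iy ⟩
        X ^ (n ∸ toℕ i) * (X ^ toℕ i * y)       ER.≈⟨ lift (*-assoc (X ^ (n ∸ toℕ i)) (X ^ toℕ i) y) ⟨
        X ^ (n ∸ toℕ i) * X ^ toℕ i * y         ER.≈⟨ lift (*-congʳ {y} (trans (sym (^-homo-* X (n ∸ toℕ i) (toℕ i)))
                                                     (trans (^-congʳ X (ℕ.m∸n+n≡m i≤n)) X^n≈1))) ⟩
        1# * y                                  ER.≈⟨ lift (*-identityˡ y) ⟩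
        y                                       ER.∎

    covers : ∀ x → (∃ λ (i : Fin n) → ∃ λ y → (x ≈ₑ X ^ toℕ i * y) × (y ^ (2 ℕ.+ A) ≈ₑ y)) →
      Σ ℕ λ l → Σ (l ℕ.< n) λ _ → Σ V λ u → (u ^ Q ≈ₑ u) × (x ≈ Space.σ^ F n l u)
    covers x (i , y , x≈ , y-fixed) = toℕ i , Fin.toℕ<n i , shift-into-U x i y x≈ y-fixed

  covering : Coprime n (suc A) → CyclicallyCovering U
  covering coprime x = by-cases (x ≟ₑ 0#)
    where
    by-cases : Dec (x ≈ₑ 0#) → Σ ℕ λ l → Σ (l ℕ.< n) λ _ → Σ V λ u → (u ^ Q ≈ₑ u) × (x ≈ Space.σ^ F n l u)
    by-cases (yes x≈0) = 0 , s≤s z≤n , x , U-resp {x} {0#} x≈0 (lift 0^Q) , refl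
    by-cases (no x≉0)  = covers x (decompose coprime x x≉0)

  -- F embeds in E: a e = 0 with a nonzero would force e = 0.
  constant≈0 : ∀ a → constant a ≈ₑ 0# → F._≈_ a F.0#
  constant≈0 a ca≈0 = decidable-stable (F._≟_ a F.0#) λ a≉0 → e≉0 (e≈0 a≉0)
    where
    ae≈0 : (a ·V e) ≈ 0#
    ae≈0 = RR.begin
      (a ·V e)         RR.≈⟨ constant-* a e ⟨
      constant a * e   RR.≈⟨ *-comm (constant a) e ⟩
      e * constant a   RR.≈⟨ ca≈0 ⟩
      e * 0#           RR.≈⟨ zeroʳ e ⟩
      0#               RR.∎
    e≈0 : ¬ F._≈_ a F.0# → e ≈ 0#
    e≈0 a≉0 j = cancel a (e j) a≉0 (ae≈0 j)

  module _ (N≤n : N ℕ.≤ n) (distinct : ∀ i s → 0 ℕ.< s → i ℕ.+ s ℕ.< N → ¬ n ∣ q ℕ.^ (i ℕ.+ s) ∸ q ℕ.^ i) where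
    private
      L = n ∸ N

      high<n : ∀ (j : Fin L) → N ℕ.+ toℕ j ℕ.< n
      high<n j = ℕ.<-≤-trans (ℕ.+-monoʳ-< N (Fin.toℕ<n j)) (ℕ.≤-reflexive (ℕ.m+[n∸m]≡n N≤n))

      high : V → Fin L → F.Carrier
      high u j = u (fromℕ< (high<n j))

      from-high : ∀ {P : F.Carrier → Set} (u : V) → (∀ j → P (high u j)) → ∀ i → N ℕ.≤ toℕ i → P (u i)
      from-high {P} u Pu i N≤i = ≡.subst (λ i → P (u i)) (Fin.toℕ-injective eq) (Pu j)
        where
        j<L : toℕ i ∸ N ℕ.< L
        j<L = ℕ.∸-monoˡ-< (Fin.toℕ<n i) N≤i
        j = fromℕ< j<L
        eq : toℕ (fromℕ< (high<n j)) ≡ toℕ i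
        eq = ≡.trans (Fin.toℕ-fromℕ< (high<n j)) (≡.trans (≡.cong (N ℕ.+_) (Fin.toℕ-fromℕ< j<L)) (ℕ.m+[n∸m]≡n N≤i))

    -- Such a w is a polynomial of degree less than N that vanishes at X in E. So the coordinates
    -- from N on, together with the class in E, determine a vector.
    kernel-high : ∀ w → w ≈ₑ 0# → (∀ j → F._≈_ (high w j) F.0#) → w ≈ 0#
    kernel-high w w≈0 high≈0 i with toℕ i ℕ.<? N
    ... | no i≮N  = from-high {λ a → F._≈_ a F.0#} w high≈0 i (ℕ.≮⇒≥ i≮N)
    ... | yes i<N = ≡.subst (λ i → F._≈_ (w i) F.0#) index≡ (constant≈0 (w (inject≤ (fromℕ< i<N) N≤n))
        (independent q N N≤n distinct (s≤s (s≤s z≤n)) w (λ i → constant (w i)) (λ j → expand-^ j w) w≈0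
          (λ i N≤i j → F.trans (F.*-congʳ (from-high {λ a → F._≈_ a F.0#} w high≈0 i N≤i)) (F.zeroˡ _)) (fromℕ< i<N)))
      where
      index≡ : inject≤ (fromℕ< i<N) N≤n ≡ i
      index≡ = Fin.toℕ-injective (≡.trans (Fin.toℕ-inject≤ (fromℕ< i<N) N≤n) (Fin.toℕ-fromℕ< i<N))

    Classes : Set
    Classes = ∃ λ s → ∃ λ (g : Fin s → V) →
      (∀ i j → g i ≈ₑ g j → i ≡ j) × (∀ i → g i ^ Q ≈ₑ g i) ×
      (∀ j → decode n j ^ Q ≈ₑ decode n j → ∃ λ i → g i ≈ₑ decode n j)

    -- Label a vector of U by its n - N high coordinates and its class in L. Two vectors with the
    -- same label have a difference covered by `kernel-high`, so q^m ≤ q^(n-N) q^k and m ≤ n - M.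
    dimension-from : Classes → ∀ m → HasDim U m → m ℕ.+ M ℕ.≤ n
    dimension-from (s , g , g-injective , g-fixed , complete) m dim = ℕ.≤-trans (ℕ.+-monoˡ-≤ M m≤L+k)
        (ℕ.≤-reflexive (≡.trans (ℕ.+-assoc L k M) (ℕ.m∸n+n≡m N≤n)))
      where
      class : ∀ u → u ^ Q ≈ₑ u → ∃ λ i → g i ≈ₑ u
      class u u∈ = let i , eq = complete (code u) (U-resp {decode n (code u)} {u} (lift (decode-code u)) u∈)
                   in i , E.trans {g i} {decode n (code u)} {u} eq (lift (decode-code u))
      f : ∀ u → u ^ Q ≈ₑ u → Fin (q ℕ.^ L ℕ.* s)
      f u u∈ = Fin.combine (code (high u)) (proj₁ (class u u∈))
      f-injective : ∀ {u v} u∈ v∈ → f u u∈ ≡ f v v∈ → u ≈ v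
      f-injective {u} {v} u∈ v∈ eq j = F-x-y≈0⇒x≈y _ _ (kernel-high (u + - v) u-v≈0
          (λ j → F-x≈y⇒x-y≈0 (code-injective (high u) (high v) (proj₁ same) j)) j)
        where
        open import Algebra.Properties.Group F.+-group using () renaming
          (x∙y⁻¹≈ε⇒x≈y to F-x-y≈0⇒x≈y; x≈y⇒x∙y⁻¹≈ε to F-x≈y⇒x-y≈0)
        same = Fin.combine-injective (code (high u)) (proj₁ (class u u∈)) (code (high v)) (proj₁ (class v v∈)) eq
        u≈v : u ≈ₑ v
        u≈v = E.trans {u} {g (proj₁ (class u u∈))} {v} (sym (proj₂ (class u u∈)))
          (E.trans {g (proj₁ (class u u∈))} {g (proj₁ (class v v∈))} {v} (E.reflexive (≡.cong g (proj₂ same))) (proj₂ (class v v∈)))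
        u-v≈0 : (u + - v) ≈ₑ 0#
        u-v≈0 = E.trans {u + - v} {v + - v} {0#} (E.+-congʳ { - v} {u} {v} u≈v) (E.-‿inverseʳ v)
      s≤Q : s ℕ.≤ q ℕ.^ k
      s≤Q = ℕ.≤-trans (fixed-bound g g-injective λ i → E.trans {g i ^ (2 ℕ.+ A)} {g i ^ Q} {g i} (lift (sym (^Q (g i)))) (g-fixed i))
        (ℕ.≤-reflexive (≡.sym q^k≡))
      m≤L+k : m ℕ.≤ L ℕ.+ k
      m≤L+k = ^-cancelʳ-≤ q (s≤s (s≤s z≤n)) (ℕ.≤-trans (dim-bound n {U} dim f (λ {u} {v} → f-injective {u} {v}))
        (ℕ.≤-trans (ℕ.*-monoʳ-≤ (q ℕ.^ L) s≤Q) (ℕ.≤-reflexive (≡.sym (ℕ.^-distribˡ-+-* q L k)))))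

    dimension : ∀ m → HasDim U m → m ℕ.+ M ℕ.≤ n
    dimension = dimension-from (transversal {A = V} {_~_ = _≈ₑ_} {P = λ u → u ^ Q ≈ₑ u} _≟ₑ_ U?
      (λ x → E.refl {x}) (λ {x} {y} → E.sym {x} {y}) (decode n))

open import Data.Nat using (ℕ; _*_; _^_; _∸_)

-- The value of h, with the degenerate cases.

module CodimensionFormula {r} (F : FiniteField (2 ℕ.+ r)) (n′ k d A : ℕ)
  (q^k≡ : (2 ℕ.+ r) ^ k ≡ 2 ℕ.+ A) (n≡ : suc n′ ≡ geomSum (2 ℕ.+ r) k (suc d))
  (coprime : Coprime (suc n′) (suc A)) where

  open LinearAlgebra F
  open Space F (suc n′)

  private
    -- Here `suc d` is the d of the theorem, so M = kd and N = k(d + 1) in its notation. That it is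
    -- positive gives k ≤ M and q^M < n.
    q n M N : ℕ
    q = 2 ℕ.+ r
    n = suc n′
    M = k * suc d
    N = k ℕ.+ M

    1<q : 1 ℕ.< q
    1<q = s≤s (s≤s z≤n)

    q^N≡ : q ^ N ≡ suc (n * suc A)
    q^N≡ = ≡.trans (≡.cong (q ^_) (≡.sym (ℕ.*-suc k (suc d))))
      (≡.trans (≡.sym (geomSum-* q k (suc d) q^k≡)) (≡.cong (λ m → suc (m * suc A)) (≡.sym n≡)))

    k≤M : k ℕ.≤ M
    k≤M = ℕ.m≤m*n k (suc d)

    q^M<n : q ^ M ℕ.< n
    q^M<n = ℕ.<-≤-trans (ℕ.+-monoˡ-≤ (q ^ M) (geomSum-positive q k d)) (ℕ.≤-reflexive (≡.sym n≡))

    -- N = k + M ≤ 2M ≤ q^M < n.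
    N≤n : N ℕ.≤ n
    N≤n = ℕ.≤-trans (ℕ.+-monoˡ-≤ M k≤M) (ℕ.≤-trans (2m≤q^m q M 1<q) (ℕ.<⇒≤ q^M<n))

  codim-bound : ∀ U c → CyclicallyCovering U → HasCodim U c → c ℕ.≤ M
  codim-bound U c cover codim = geomSum-bound q k (suc d) 1<q q^k≡ c
    (≡.subst (q ^ c ℕ.≤_) n≡ (covering-codim n U c cover codim))

  attained : CyclicField.Idempotent F n′ k M A q^k≡ q^N≡ → Σ Subspace λ U → CyclicallyCovering U × HasCodim U M
  attained idem = U , covering coprime , codim (decidable⇒basis n U U?)
    where
    open FixedSubspace F n′ k M A q^k≡ q^N≡ idem
    codim : ∃ (HasDim U) → HasCodim U M
    -- `dimension` shows only that the codimension is at least M; the reverse is the counting bound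
    -- applied to U, which is already known to cover.
    codim (m , dim) = m , dim , ℕ.≤-antisym m+M≤n
      (ℕ.≤-trans (ℕ.m≤n+m∸n n m) (ℕ.+-monoʳ-≤ m (codim-bound U (n ∸ m) (covering coprime) (m , dim , ℕ.m+[n∸m]≡n m≤n))))
      where
      m+M≤n : m ℕ.+ M ℕ.≤ n
      m+M≤n = dimension N≤n (powers-distinct q n (suc A) k M 1<q q^N≡ k≤M q^M<n) m dim
      m≤n : m ℕ.≤ n
      m≤n = ℕ.m+n≤o⇒m≤o m m+M≤n

  h : hIs M
  h = attained (CyclicField.idempotent F n′ k M A q^k≡ q^N≡) , codim-bound

1<⇒2+ : ∀ m → 1 ℕ.< m → ∃ λ A → m ≡ 2 ℕ.+ A
1<⇒2+ (suc (suc A)) _ = A , ≡.refl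
1<⇒2+ (suc zero) (s≤s ())

-- The case d = 0: with n = 1 the only shift is trivial, and counting gives q^c ≤ 1.
h-one : ∀ {r} (F : FiniteField (2 ℕ.+ r)) → Space.hIs F 1 0
h-one F = (full 1 , (λ x → 0 , s≤s z≤n , x , _ , λ i → FiniteField.refl F) , full-codim)
  , λ U c cover codim → ^-cancelʳ-≤ _ (s≤s (s≤s z≤n)) (covering-codim 1 U c cover codim)
  where open LinearAlgebra F

h-geomSum : ∀ r k d → gcd (d ℕ.+ 1) ((2 ℕ.+ r) ^ k ∸ 1) ≡ 1 → (F : FiniteField (2 ℕ.+ r)) →
  ∀ n → n ≡ geomSum (2 ℕ.+ r) k d → Space.hIs F n (k * d)
h-geomSum r k zero gcd≡1 F _ ≡.refl = ≡.subst (Space.hIs F 1) (≡.sym (ℕ.*-zeroʳ k)) (h-one F)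
-- For k = 0 the second argument of the gcd is 0, so the gcd is the first argument, which is at
-- least 2.
h-geomSum r zero (suc d) gcd≡1 F n n≡ = contradiction (ℕ.suc-injective (≡.trans (≡.sym (gcd-identityʳ _)) gcd≡1))
  (ℕ.m+1+n≢0 d)
h-geomSum r k@(suc _) (suc d) gcd≡1 F zero n≡ = contradiction (ℕ.≤-trans (geomSum-positive (2 ℕ.+ r) k (suc d)) (ℕ.≤-reflexive (≡.sym n≡))) λ ()
h-geomSum r k@(suc _) (suc d) gcd≡1 F (suc n′) n≡
  with 1<⇒2+ ((2 ℕ.+ r) ^ k) (ℕ.≤-trans (s≤s (s≤s z≤n)) (m<q^m (2 ℕ.+ r) k (s≤s (s≤s z≤n))))
... | A , q^k≡ = CodimensionFormula.h F n′ k d A q^k≡ n≡ (≡.subst (λ m → Coprime m (suc A)) (≡.sym n≡)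
  (geomSum-coprime (2 ℕ.+ r) k (suc d) q^k≡ (≡.subst (λ m → gcd (suc d ℕ.+ 1) (m ∸ 1) ≡ 1) q^k≡ gcd≡1)))

theorem3p4 : (q k d : ℕ) → gcd (d Data.Nat.+ 1) (q ^ k ∸ 1) ≡ 1 →
    (F : FiniteField q) → Space.hIs F (geomSum q k d) (k * d)
theorem3p4 zero k d gcd≡1 F with FiniteField.enum-surj F (FiniteField.0# F)
... | () , _
theorem3p4 (suc zero) k d gcd≡1 F with FiniteField.enum-surj F (FiniteField.0# F) | FiniteField.enum-surj F (FiniteField.1# F)
... | zero , x≈0 | zero , x≈1 = contradiction (FiniteField.trans F (FiniteField.sym F x≈0) x≈1) (FiniteField.0≉1 F)
theorem3p4 (suc (suc r)) k d gcd≡1 F = h-geomSum r k d gcd≡1 F _ ≡.refl
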